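{- Let $\mathbb F_q$ be a finite field. Suppose that $B_1\subseteq\mathbb F_q^{m_1}$ is $C_1$-weakly Sidorenko and $B_2\subseteq\mathbb F_q^{m_2}$ is $C_2$-weakly Sidorenko. Then $B_1\times B_2\subseteq\mathbb F_q^{m_1+m_2}$ is $C_1C_2$-weakly Sidorenko. In particular, if $B_1$ and $B_2$ are both Sidorenko, then so is $B_1\times B_2$.
   Context: An affine relation among $x_1,\ldots,x_k\in\mathbb F_q^n$ is an equation $\sum\lambda_ix_i=0$ with $\lambda_i\in\mathbb F_q$ and $\sum\lambda_i=0$. For a set $B\subseteq\mathbb F_q^m$, $\mathrm{rank}_{\mathrm{aff}}(B)$ is the size of a maximal affinely independent subset of $B$ (a set with no nontrivial affine relation). For $B\subseteq\mathbb F_q^m$ and $A\subseteq\mathbb F_q^n$, an affine homomorphism $B\to A$ is a function $\varphi:B\to A$ that extends to an affine map $\mathbb F_q^m\to\mathbb F_q^n$ (equivalently, preserves affine relations), and $\mathrm{hom}_{\mathrm{aff}}(B,A)$ is the number of such functions. $B\subseteq\mathbb F_q^m$ is called $C$-weakly Sidorenko if for every $n$ and every $A\subseteq\mathbb F_q^n$ with $|A|=\alpha q^n$ we have $\mathrm{hom}_{\mathrm{aff}}(B,A)\ge\alpha^C N^{\mathrm{rank}_{\mathrm{aff}}(B)}$, where $N=q^n$; $B$ is Sidorenko if it is $|B|$-weakly Sidorenko. The product is $B_1\times B_2=\{(x,y)\in\mathbb F_q^{m_1+m_2}: x\in B_1,y\in B_2\}$.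
   Formalization: The constants C₁ and C₂ are taken to be nonnegative rationals a/b (with the defining inequality multiplied out) instead of real numbers; the real case follows by monotonicity in C and a limit. -}

module Defs where

open import Level using (0ℓ)
open import Data.Nat as ℕ using (ℕ; zero; suc; _≤_; _^_)
open import Data.List as List using (List; []; _∷_; length; cartesianProductWith; filter; zip; concatMap)
open import Data.List.Membership.Propositional using (_∈_)
open import Data.List.Relation.Unary.Unique.Propositional using (Unique)
open import Data.List.Relation.Unary.All as All using (All)
open import Data.List.Relation.Unary.Any as Any using (Any)
open import Data.List.Relation.Binary.Sublist.Propositional using (_⊆_)
open import Data.Vec as Vec using (Vec; []; _∷_; _++_)
import Data.Vec.Properties as VecP
open import Data.Product using (Σ; _×_; _,_; ∃; proj₁; proj₂)
open import Relation.Nullary using (¬_; Dec)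
open import Relation.Binary.PropositionalEquality using (_≡_)
open import Relation.Binary.Definitions using (DecidableEquality)
open import Algebra.Structures using (IsCommutativeRing)

record FiniteField : Set₁ where
  infixl 6 _+_
  infixl 7 _*_
  field
    Carrier   : Set
    _+_ _*_   : Carrier → Carrier → Carrier
    -_        : Carrier → Carrier
    0# 1#     : Carrier
    isCommutativeRing : IsCommutativeRing _≡_ _+_ _*_ -_ 0# 1#
    0≢1       : ¬ (0# ≡ 1#)
    inverse   : ∀ x → ¬ (x ≡ 0#) → ∃ λ y → x * y ≡ 1#
    _≟_       : DecidableEquality Carrier
    elements  : List Carrier
    complete  : ∀ x → x ∈ elements
    distinct  : Unique elements

  order : ℕ
  order = length elements

module _ (F : FiniteField) where
  open FiniteField F

  Pt : ℕ → Set
  Pt n = Vec Carrier n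

  sumF : ∀ {k} → Vec Carrier k → Carrier
  sumF = Vec.foldr _ _+_ 0#

  zeroV : ∀ {n} → Pt n
  zeroV = Vec.replicate _ 0#

  _+V_ : ∀ {n} → Pt n → Pt n → Pt n
  _+V_ = Vec.zipWith _+_

  _·V_ : ∀ {n} → Carrier → Pt n → Pt n
  c ·V v = Vec.map (c *_) v

  lincomb : ∀ {n k} → Vec Carrier k → Vec (Pt n) k → Pt n
  lincomb λs xs = Vec.foldr _ _+V_ zeroV (Vec.zipWith _·V_ λs xs)

  AffIndep : ∀ {n} → List (Pt n) → Set
  AffIndep xs = ∀ (λs : Vec Carrier (length xs)) →
    sumF λs ≡ 0# → lincomb λs (Vec.fromList xs) ≡ zeroV →
    λs ≡ Vec.replicate _ 0#

  -- r = rank_aff(B): the size of a maximal affinely independent subset of B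
  -- (all maximal ones have the same size, so this is the largest size).
  IsAffRank : ∀ {m} → List (Pt m) → ℕ → Set
  IsAffRank B r =
    (Σ (List (Pt _)) λ S → S ⊆ B × AffIndep S × length S ≡ r) ×
    (∀ S → S ⊆ B → AffIndep S → length S ≤ r)

  AffMap : ℕ → ℕ → Set
  AffMap m n = Vec (Pt m) n × Pt n

  dot : ∀ {m} → Pt m → Pt m → Carrier
  dot x y = sumF (Vec.zipWith _*_ x y)

  applyAff : ∀ {m n} → AffMap m n → Pt m → Pt n
  applyAff (M , v) x = Vec.map (λ row → dot row x) M +V v

  allVecs : ∀ {A : Set} → List A → (n : ℕ) → List (Vec A n)
  allVecs xs zero    = [] ∷ []
  allVecs xs (suc n) = cartesianProductWith _∷_ xs (allVecs xs n)

  allAffMaps : ∀ m n → List (AffMap m n)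
  allAffMaps m n = cartesianProductWith _,_ (allVecs (allVecs elements m) n) (allVecs elements n)

  allTuples : ∀ {A : Set} → List A → ℕ → List (List A)
  allTuples xs zero    = [] ∷ []
  allTuples xs (suc k) = cartesianProductWith _∷_ xs (allTuples xs k)

  Extends : ∀ {m n} → List (Pt m) → List (Pt n) → AffMap m n → Set
  Extends B t L = All (λ p → applyAff L (proj₁ p) ≡ proj₂ p) (zip B t)

  extends? : ∀ {m n} (B : List (Pt m)) (t : List (Pt n)) (L : AffMap m n) → Dec (Extends B t L)
  extends? B t L = All.all? (λ p → VecP.≡-dec _≟_ (applyAff L (proj₁ p)) (proj₂ p)) (zip B t)

  extendable? : ∀ {m n} (B : List (Pt m)) (t : List (Pt n)) →
    Dec (Any (Extends B t) (allAffMaps m n))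
  extendable? B t = Any.any? (extends? B t) (allAffMaps _ _)

  -- hom_aff(B, A): number of functions φ : B → A (given by the tuple of
  -- images of the distinct elements of B) that extend to an affine map.
  homAff : ∀ {m n} → List (Pt m) → List (Pt n) → ℕ
  homAff B A = length (filter (extendable? B) (allTuples A (length B)))

  -- B is C-weakly Sidorenko with C = a / b (a, b ∈ ℕ, b ≠ 0):
  --   for all n and all A ⊆ F_q^n with |A| = α N  (N = q^n),
  --   hom_aff(B,A) ≥ α^(a/b) N^r,  r = rank_aff(B),
  -- which, multiplied out, is  |A|^a · N^(r b) ≤ hom_aff(B,A)^b · N^a.
  WeaklySidorenko : ∀ {m} → List (Pt m) → (a b : ℕ) → Set
  WeaklySidorenko B a b =
    ∀ r → IsAffRank B r →
    ∀ n (A : List (Pt n)) → Unique A →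
    length A ^ a ℕ.* (order ^ n) ^ (r ℕ.* b) ≤ homAff B A ^ b ℕ.* (order ^ n) ^ a

  Sidorenko : ∀ {m} → List (Pt m) → Set
  Sidorenko B = WeaklySidorenko B (length B) 1

  _×ᴮ_ : ∀ {m₁ m₂} → List (Pt m₁) → List (Pt m₂) → List (Pt (m₁ ℕ.+ m₂))
  B₁ ×ᴮ B₂ = cartesianProductWith _++_ B₁ B₂

{-# OPTIONS --safe #-}

-- An affine homomorphism φ of B₁ × B₂ splits as φ(x, y) = t(x) + s(y), uniquely once t vanishes at a
-- base point x₀ of B₁. For fixed t, the maps s that send B₁ × B₂ into A are the homomorphisms from B₂
-- to A_t = {v : t + v ⊆ A}, so hom(B₁ × B₂, A) ≥ Σ_t hom(B₂, A_t), while Σ_t |A_t| ≥ hom(B₁, A).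
-- The hypothesis on B₂ bounds hom(B₂, A_t) below by a function of |A_t| that is convex, since C₂ ≥ 1;
-- Jensen over the at most N^(r₁ - 1) maps t and the hypothesis on B₁ give the exponent C₁ C₂.
-- The rank inequality r₁₂ + 1 ≤ r₁ + r₂ follows by comparing powers of q along an injective map of
-- coefficient vectors, and the bound on the number of maps t by restriction to an affine basis of B₁.

module Submission where

open import Defs
open import Level using (0ℓ)
open import Data.Nat
open import Data.Nat.Properties
open import Data.Nat.ListAction using (sum)
open import Data.Nat.Tactic.RingSolver using (solve-∀)
open import Data.List using (List; []; _∷_; length; map; _++_; filter; concatMap; cartesianProduct; cartesianProductWith)
open import Data.List.Properties using (length-++; length-map; length-filter; ∷-injective; map-∘; map-cong; map-id; map-++; map-injective; cartesianProductWith-zeroʳ)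
open import Data.List.Membership.Propositional using (_∈_)
open import Data.List.Membership.Propositional.Properties using (∈-∃++; ∈-++⁻; ∈-++⁺ˡ; ∈-++⁺ʳ; ∈-map⁻; ∈-map⁺; ∈-filter⁺; ∈-filter⁻; ∈-length; ∈-cartesianProduct⁻; ∈-cartesianProductWith⁺; ∈-cartesianProductWith⁻)
import Data.List.Membership.DecPropositional as DecMembership
open import Data.List.Relation.Unary.Any as Any using (Any; here; there)
open import Data.List.Relation.Unary.All as All using (All; []; _∷_)
import Data.List.Relation.Unary.All.Properties as AllP
open import Data.List.Relation.Unary.Unique.Propositional using (Unique; []; _∷_)
import Data.List.Relation.Unary.Unique.Propositional.Properties as UniqueP
open import Data.List.Relation.Binary.Sublist.Propositional using (_⊆_; []; _∷_; _∷ʳ_; lookup)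
open import Data.Vec as Vec using (Vec; []; _∷_)
import Data.Vec.Properties as VecP
open import Data.Product using (_×_; _,_; ∃; proj₁; proj₂)
open import Data.Sum using (_⊎_; inj₁; inj₂)
open import Data.Empty using (⊥-elim)
open import Function using (_∘_; id)
open import Relation.Nullary using (¬_; Dec; yes; no)
open import Relation.Nullary.Decidable using (_×-dec_; ¬?)
open import Relation.Binary.PropositionalEquality
open import Algebra.Bundles using (CommutativeRing)
import Algebra.Properties.Ring as RingP
import Algebra.Properties.CommutativeSemigroup as CommutativeSemigroupP

-- In densities the count closes exactly. With N^(r₁ - 1) maps t, the hypothesis on B₁ makes the
-- average of |A_t| at least α^C₁ N, the hypothesis on B₂ turns this into (α^C₁)^C₂ N^r₂
-- homomorphisms per map, and the total is α^(C₁ C₂) N^(r₁ + r₂ - 1). So the rank of the product has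
-- to be bounded only from above. Jensen leaves the number K of maps in the denominator with
-- exponent C₂ - 1. As this exponent is nonnegative, an upper bound for K is enough. The bound C₂ ≥
-- 1 comes from the hypothesis on B₂ itself, but only for nonempty B₂: the empty set is C-weakly
-- Sidorenko for every C. Empty factors are therefore separated off, which also provides the base
-- points as heads of the lists. The constants are fractions a/b and all inequalities are cleared of
-- roots and denominators. Jensen thus has to be proved inside ℕ, where e = a₂ - b₂ stands for the
-- numerator of C₂ - 1.

private variable
  I : Set

-- Power-mean inequality over ℕ

^-distribʳ-* : ∀ n x y → (x * y) ^ n ≡ x ^ n * y ^ n
^-distribʳ-* zero    x y = refl
^-distribʳ-* (suc n) x y rewrite ^-distribʳ-* n x y = swap x y (x ^ n) (y ^ n)
  where
  swap : ∀ a b c d → a * b * (c * d) ≡ a * c * (b * d)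
  swap = solve-∀

2xy≤x²+y² : ∀ x y → 2 * (x * y) ≤ x * x + y * y
2xy≤x²+y² x y with ≤-total x y
... | inj₁ x≤y = ordered x≤y
  where
  square : ∀ x k → x * x + (x + k) * (x + k) ≡ 2 * (x * (x + k)) + k * k
  square = solve-∀
  ordered : ∀ {x y} → x ≤ y → 2 * (x * y) ≤ x * x + y * y
  ordered {x} {y} x≤y with k , refl ← m≤n⇒∃[o]m+o≡n x≤y =
    ≤-trans (m≤m+n _ (k * k)) (≤-reflexive (sym (square x k)))
... | inj₂ y≤x with k , refl ← m≤n⇒∃[o]m+o≡n y≤x =
    ≤-trans (m≤m+n _ (k * k)) (≤-reflexive (sym (square y k)))
  where
  square : ∀ y k → (y + k) * (y + k) + y * y ≡ 2 * ((y + k) * y) + k * k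
  square = solve-∀

-- The tangent inequality y^(n+1) ≥ x^(n+1) + (n+1) x^n (y − x), without subtraction.
tangent : ∀ n x y → (1 + n) * (x ^ n * y) ≤ n * x ^ (1 + n) + y ^ (1 + n)
tangent zero    x y = ≤-reflexive (base y)
  where
  base : ∀ y → (1 + 0) * (1 * y) ≡ 0 + y * 1
  base = solve-∀
tangent (suc n) x y = +-cancelˡ-≤ (n * (x * p * y)) _ _ (begin
  n * (x * p * y) + (2 + n) * (x * p * y)                ≡⟨ split n p x y ⟩
  (1 + n) * p * (2 * (x * y))                            ≤⟨ *-monoʳ-≤ ((1 + n) * p) (2xy≤x²+y² x y) ⟩
  (1 + n) * p * (x * x + y * y)                          ≡⟨ expand n p x y ⟩
  (1 + n) * (x * (x * p)) + y * ((1 + n) * (p * y))      ≤⟨ +-monoʳ-≤ ((1 + n) * (x * (x * p))) (*-monoʳ-≤ y (tangent n x y)) ⟩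
  (1 + n) * (x * (x * p)) + y * (n * (x * p) + y ^ (1 + n)) ≡⟨ collect n p x y (y ^ (1 + n)) ⟩
  n * (x * p * y) + ((1 + n) * (x * (x * p)) + y * y ^ (1 + n)) ∎)
  where
  open ≤-Reasoning
  p = x ^ n
  split : ∀ n p x y → n * (x * p * y) + (2 + n) * (x * p * y) ≡ (1 + n) * p * (2 * (x * y))
  split = solve-∀
  expand : ∀ n p x y → (1 + n) * p * (x * x + y * y) ≡ (1 + n) * (x * (x * p)) + y * ((1 + n) * (p * y))
  expand = solve-∀
  collect : ∀ n p x y z → (1 + n) * (x * (x * p)) + y * (n * (x * p) + z)
    ≡ n * (x * p * y) + ((1 + n) * (x * (x * p)) + y * z)
  collect = solve-∀

-- Induction step of AM-GM: the mean S/n of n numbers is replaced by the mean (S + x)/(1 + n).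
mean-step : ∀ n .{{_ : NonZero n}} S x →
  (1 + n) ^ (1 + n) * (S ^ n * x) ≤ (S + x) ^ (1 + n) * n ^ n
mean-step n S x = *-cancelˡ-≤ n (+-cancelˡ-≤ (n * (S * (1 + n) * (P * Q))) _ _ (begin
  n * (S * (1 + n) * (P * Q)) + n * ((1 + n) * Q * (P * x))    ≡⟨ collect n P Q S x ⟩
  (1 + n) * (P * Q * ((S + x) * n))                            ≡⟨ cong (λ z → (1 + n) * (z * ((S + x) * n))) (^-distribʳ-* n S (1 + n)) ⟨
  -- The two points are the means S/n and (S + x)/(1 + n), both scaled by n (1 + n).
  (1 + n) * ((S * (1 + n)) ^ n * ((S + x) * n))                ≤⟨ tangent n (S * (1 + n)) ((S + x) * n) ⟩
  n * (S * (1 + n)) ^ (1 + n) + ((S + x) * n) ^ (1 + n)        ≡⟨ cong₂ (λ u v → n * (S * (1 + n) * u) + v) (^-distribʳ-* n S (1 + n)) (^-distribʳ-* (1 + n) (S + x) n) ⟩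
  n * (S * (1 + n) * (P * Q)) + (S + x) ^ (1 + n) * (n * n ^ n) ≡⟨ cong (n * (S * (1 + n) * (P * Q)) +_) (swap n ((S + x) ^ (1 + n)) (n ^ n)) ⟩
  n * (S * (1 + n) * (P * Q)) + n * ((S + x) ^ (1 + n) * n ^ n) ∎))
  where
  open ≤-Reasoning
  P = S ^ n
  Q = (1 + n) ^ n
  collect : ∀ n P Q S x → n * (S * (1 + n) * (P * Q)) + n * ((1 + n) * Q * (P * x)) ≡ (1 + n) * (P * Q * ((S + x) * n))
  collect = solve-∀
  swap : ∀ n w v → w * (n * v) ≡ n * (w * v)
  swap = solve-∀

-- AM-GM for b copies of u and e copies of v, with (b + e)^(b + e) in place of a division. Copies of
-- u alone give equality, and `mean-step` admits one more copy of v at a time.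
weighted-AM-GM : ∀ b .{{_ : NonZero b}} e u v →
  (b + e) ^ (b + e) * (u ^ b * v ^ e) ≤ (b * u + e * v) ^ (b + e)
weighted-AM-GM b zero u v rewrite +-identityʳ b | +-identityʳ (b * u) | *-identityʳ (u ^ b) =
  ≤-reflexive (sym (^-distribʳ-* b b u))
weighted-AM-GM b (suc e) u v rewrite +-suc b e = *-cancelˡ-≤ (n ^ n) (begin
  n ^ n * ((1 + n) ^ (1 + n) * (u ^ b * (v * v ^ e)))  ≡⟨ reorder (n ^ n) ((1 + n) ^ (1 + n)) (u ^ b) v (v ^ e) ⟩
  (1 + n) ^ (1 + n) * (n ^ n * (u ^ b * v ^ e) * v)    ≤⟨ *-monoʳ-≤ ((1 + n) ^ (1 + n)) (*-monoˡ-≤ v (weighted-AM-GM b e u v)) ⟩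
  (1 + n) ^ (1 + n) * (S ^ n * v)                      ≤⟨ mean-step n S v ⟩
  (S + v) ^ (1 + n) * n ^ n                            ≡⟨ cong (λ z → z ^ (1 + n) * n ^ n) (shift (b * u) e v) ⟩
  (b * u + (v + e * v)) ^ (1 + n) * n ^ n              ≡⟨ *-comm _ (n ^ n) ⟩
  n ^ n * (b * u + (v + e * v)) ^ (1 + n)              ∎)
  where
  open ≤-Reasoning
  n = b + e
  S = b * u + e * v
  instance
    n≢0 : NonZero n
    n≢0 = >-nonZero (≤-trans (>-nonZero⁻¹ b) (m≤m+n b e))
    nⁿ≢0 : NonZero (n ^ n)
    nⁿ≢0 = m^n≢0 n n
  reorder : ∀ N M U v V → N * (M * (U * (v * V))) ≡ M * (N * (U * V) * v)
  reorder = solve-∀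
  shift : ∀ s e v → s + e * v + v ≡ s + (v + e * v)
  shift = solve-∀

sum-map-affine : ∀ (b c : ℕ) (y : I → ℕ) is →
  sum (map (λ i → b * y i + c) is) ≡ b * sum (map y is) + length is * c
sum-map-affine b c y []       rewrite *-zeroʳ b = refl
sum-map-affine b c y (i ∷ is) rewrite sum-map-affine b c y is =
  regroup b c (y i) (sum (map y is)) (length is)
  where
  regroup : ∀ b c y s l → b * y + c + (b * s + l * c) ≡ b * (y + s) + (c + l * c)
  regroup = solve-∀

∈⇒≤sum : ∀ (y : I → ℕ) {is i} → i ∈ is → y i ≤ sum (map y is)
∈⇒≤sum y {i = i} (here refl) = m≤m+n (y i) _
∈⇒≤sum y {is = j ∷ _} (there i∈) = ≤-trans (∈⇒≤sum y i∈) (m≤n+m _ (y j))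

-- Otherwise x i T < X t i at every index with t i positive. The remaining indices contribute
-- nothing to either sum, so summation would give X T < X T.
pigeonhole : ∀ (x t : I → ℕ) is → (∀ i → i ∈ is → t i ≡ 0 → x i ≡ 0) → 0 < sum (map t is) →
  ∃ λ i → i ∈ is × 0 < t i × sum (map x is) * t i ≤ x i * sum (map t is)
pigeonhole x t is null T>0 = conclude (search is (λ i i∈ → null i i∈))
  where
  X = sum (map x is)
  T = sum (map t is)
  Good : _ → Set
  Good i = 0 < t i × X * t i ≤ x i * T
  -- The last alternative covers a stretch on which t vanishes: both partial sums are 0, and no
  -- strict inequality is available yet.
  search : ∀ js → (∀ i → i ∈ js → t i ≡ 0 → x i ≡ 0) → (∃ λ i → i ∈ js × Good i) ⊎
    (sum (map x js) * T < X * sum (map t js)) ⊎ (sum (map x js) ≡ 0 × sum (map t js) ≡ 0)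
  search []       _    = inj₂ (inj₂ (refl , refl))
  search (j ∷ js) null with search js (λ i i∈ → null i (there i∈))
  ... | inj₁ (i , i∈ , good) = inj₁ (i , there i∈ , good)
  ... | inj₂ rest with t j ≟ 0
  ...   | yes tj≡0 rewrite null j (here refl) tj≡0 | tj≡0 = inj₂ rest
  ...   | no  tj≢0 with X * t j ≤? x j * T
  ...     | yes ok = inj₁ (j , here refl , n≢0⇒n>0 tj≢0 , ok)
  ...     | no  xjT≱ = inj₂ (inj₁ (begin-strict
    (x j + sum (map x js)) * T      ≡⟨ *-distribʳ-+ T (x j) _ ⟩
    x j * T + sum (map x js) * T    <⟨ +-mono-<-≤ (≰⇒> xjT≱) (weaken rest) ⟩
    X * t j + X * sum (map t js)    ≡⟨ *-distribˡ-+ X (t j) _ ⟨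
    X * (t j + sum (map t js))      ∎))
    where
    open ≤-Reasoning
    weaken : (sum (map x js) * T < X * sum (map t js)) ⊎ (sum (map x js) ≡ 0 × sum (map t js) ≡ 0) →
      sum (map x js) * T ≤ X * sum (map t js)
    weaken (inj₁ lt) = <⇒≤ lt
    weaken (inj₂ (x≡0 , _)) rewrite x≡0 = z≤n
  conclude : _ → ∃ λ i → i ∈ is × Good i
  conclude (inj₁ found)            = found
  conclude (inj₂ (inj₁ lt))        = ⊥-elim (<-irrefl refl lt)
  conclude (inj₂ (inj₂ (_ , T≡0))) = ⊥-elim (<-irrefl (sym T≡0) T>0)

-- Jensen for the convex function z ↦ z^((b+e)/b), with all roots and denominators cleared.
-- At an index i where x i is at least its share under the weights t i = b y i / Y + e / K
-- (up to scaling), weighted AM-GM gives the claim after cancelling (t i)^(b+e).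
power-mean : ∀ b .{{_ : NonZero b}} e c d (x y : I → ℕ) is →
  (∀ i → i ∈ is → c * x i ^ (b + e) ≤ d * y i ^ b) →
  c * sum (map x is) ^ (b + e) ≤ d * (sum (map y is) ^ b * length is ^ e)
power-mean b e zero d x y is hyp = z≤n
-- A positive c lets the hypothesis force x i to be 0 wherever y i is 0. This settles the case Y = 0
-- and supplies the condition of `pigeonhole` in the other case.
power-mean b@(suc b′) e c@(suc _) d x y is hyp with sum (map y is) ≟ 0
... | yes Y≡0 = begin
    c * sum (map x is) ^ (b + e) ≡⟨ cong (λ z → c * z ^ (b + e)) (allZero is x≡0) ⟩
    c * 0                        ≡⟨ *-zeroʳ c ⟩
    0                            ≤⟨ z≤n ⟩
    _                            ∎
  where
  open ≤-Reasoning
  x≡0 : ∀ i → i ∈ is → x i ≡ 0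
  x≡0 i i∈ = m^n≡0⇒m≡0 (x i) (b + e) (n≤0⇒n≡0 (*-cancelˡ-≤ c (begin
    c * x i ^ (b + e)  ≤⟨ hyp i i∈ ⟩
    d * y i ^ b        ≡⟨ cong (λ z → d * z ^ b) (n≤0⇒n≡0 (≤-trans (∈⇒≤sum y i∈) (≤-reflexive Y≡0))) ⟩
    d * 0              ≡⟨ *-zeroʳ d ⟩
    0                  ≡⟨ *-zeroʳ c ⟨
    c * 0              ∎)))
  allZero : ∀ js → (∀ i → i ∈ js → x i ≡ 0) → sum (map x js) ≡ 0
  allZero []       _ = refl
  allZero (j ∷ js) h rewrite h j (here refl) = allZero js (λ i i∈ → h i (there i∈))
... | no Y≢0 = conclude (pigeonhole x t is t≡0⇒x≡0 T>0)
  where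
  open ≤-Reasoning
  a = b + e
  K = length is
  X = sum (map x is)
  Y = sum (map y is)
  t : _ → ℕ
  t i = b * K * y i + e * Y
  nonempty : ∀ js → sum (map y js) ≢ 0 → NonZero (length js)
  nonempty []      ne = ⊥-elim (ne refl)
  nonempty (_ ∷ _) _  = _
  instance
    K≢0 : NonZero K
    K≢0 = nonempty is Y≢0
    Y≢0′ : NonZero Y
    Y≢0′ = ≢-nonZero Y≢0
  T≡ : sum (map t is) ≡ Y * K * a
  T≡ = trans (sum-map-affine (b * K) (e * Y) y is) (regroup b e K Y)
    where
    regroup : ∀ b e K Y → b * K * Y + K * (e * Y) ≡ Y * K * (b + e)
    regroup = solve-∀
  T>0 : 0 < sum (map t is)
  T>0 rewrite T≡ = >-nonZero⁻¹ (Y * K * a) {{m*n≢0 (Y * K) a {{m*n≢0 Y K}}}}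
  t≡0⇒x≡0 : ∀ i → i ∈ is → t i ≡ 0 → x i ≡ 0
  t≡0⇒x≡0 i i∈ ti≡0 = m^n≡0⇒m≡0 (x i) a (n≤0⇒n≡0 (*-cancelˡ-≤ c (begin
    c * x i ^ a    ≤⟨ hyp i i∈ ⟩
    d * y i ^ b    ≡⟨ cong (λ z → d * z ^ b) yi≡0 ⟩
    d * 0          ≡⟨ *-zeroʳ d ⟩
    0              ≡⟨ *-zeroʳ c ⟨
    c * 0          ∎)))
    where
    yi≡0 : y i ≡ 0
    yi≡0 = *-cancelˡ-≡ (y i) 0 (b * K) {{m*n≢0 b K}}
      (trans (m+n≡0⇒m≡0 (b * K * y i) ti≡0) (sym (*-zeroʳ (b * K))))
  conclude : (∃ λ i → i ∈ is × 0 < t i × X * t i ≤ x i * sum (map t is)) →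
    c * X ^ a ≤ d * (Y ^ b * K ^ e)
  conclude (i , i∈ , ti>0 , share) = *-cancelʳ-≤ _ _ (t i ^ a) {{m^n≢0 (t i) a {{>-nonZero ti>0}}}} (begin
    c * X ^ a * t i ^ a                                   ≡⟨ *-assoc c (X ^ a) (t i ^ a) ⟩
    c * (X ^ a * t i ^ a)                                 ≡⟨ cong (c *_) (^-distribʳ-* a X (t i)) ⟨
    c * (X * t i) ^ a                                     ≤⟨ *-monoʳ-≤ c (^-monoˡ-≤ a share) ⟩
    c * (x i * sum (map t is)) ^ a                        ≡⟨ cong (λ z → c * (x i * z) ^ a) T≡ ⟩
    c * (x i * (Y * K * a)) ^ a                           ≡⟨ cong (c *_) (^-distribʳ-* a (x i) (Y * K * a)) ⟩
    c * (x i ^ a * (Y * K * a) ^ a)                       ≡⟨ *-assoc c (x i ^ a) ((Y * K * a) ^ a) ⟨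
    c * x i ^ a * (Y * K * a) ^ a                         ≤⟨ *-monoˡ-≤ ((Y * K * a) ^ a) (hyp i i∈) ⟩
    d * y i ^ b * (Y * K * a) ^ a                         ≡⟨ cong (d * y i ^ b *_) powers ⟩
    d * y i ^ b * (Y ^ b * Y ^ e * (K ^ b * K ^ e) * a ^ a) ≡⟨ reorder d (y i ^ b) (Y ^ b) (Y ^ e) (K ^ b) (K ^ e) (a ^ a) ⟩
    d * (Y ^ b * K ^ e) * (a ^ a * (K ^ b * y i ^ b * Y ^ e)) ≡⟨ cong (λ z → d * (Y ^ b * K ^ e) * (a ^ a * (z * Y ^ e))) (^-distribʳ-* b K (y i)) ⟨
    d * (Y ^ b * K ^ e) * (a ^ a * ((K * y i) ^ b * Y ^ e)) ≤⟨ *-monoʳ-≤ (d * (Y ^ b * K ^ e)) (weighted-AM-GM b e (K * y i) Y) ⟩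
    d * (Y ^ b * K ^ e) * (b * (K * y i) + e * Y) ^ a     ≡⟨ cong (λ z → d * (Y ^ b * K ^ e) * (z + e * Y) ^ a) (*-assoc b K (y i)) ⟨
    d * (Y ^ b * K ^ e) * t i ^ a                         ∎)
    where
    powers : (Y * K * a) ^ a ≡ Y ^ b * Y ^ e * (K ^ b * K ^ e) * a ^ a
    powers = trans (^-distribʳ-* a (Y * K) a) (cong (_* a ^ a) (trans (^-distribʳ-* a Y K)
      (cong₂ _*_ (^-distribˡ-+-* Y b e) (^-distribˡ-+-* K b e))))
    reorder : ∀ d y Yb Ye Kb Ke A → d * y * (Yb * Ye * (Kb * Ke) * A) ≡ d * (Yb * Ke) * (A * (Kb * y * Ye))
    reorder = solve-∀

-- Counting with lists

private variable
  X Y Z : Set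

-- A relation replaces the injective function because the partner of x is usually built from the
-- membership proof. Whatever is needed to recover x from y can be stored in R.
length-injection : (R : X → Y → Set) (xs : List X) (ys : List Y) → Unique xs →
  (∀ {x} → x ∈ xs → ∃ λ y → y ∈ ys × R x y) →
  (∀ {x x′ y} → R x y → R x′ y → x ≡ x′) → length xs ≤ length ys
length-injection R []       ys _         _   _   = z≤n
length-injection R (x ∷ xs) ys (x∉ ∷ u) tot inj with tot (here refl)
... | y , y∈ , Rxy with as , bs , refl ← ∈-∃++ y∈ = begin
  suc (length xs)             ≤⟨ s≤s (length-injection R xs (as ++ bs) u tot′ inj) ⟩
  suc (length (as ++ bs))     ≡⟨ cong suc (length-++ as) ⟩
  suc (length as + length bs) ≡⟨ +-suc (length as) (length bs) ⟨
  length as + suc (length bs) ≡⟨ length-++ as ⟨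
  length (as ++ y ∷ bs)       ∎
  where
  open ≤-Reasoning
  tot′ : ∀ {x′} → x′ ∈ xs → ∃ λ y′ → y′ ∈ as ++ bs × R x′ y′
  tot′ {x′} x′∈ with tot (there x′∈)
  ... | y′ , y′∈ , Rx′y′ with ∈-++⁻ as y′∈
  ...   | inj₁ y′∈as         = y′ , ∈-++⁺ˡ y′∈as , Rx′y′
  ...   | inj₂ (here refl)   = ⊥-elim (All.lookup x∉ x′∈ (inj Rxy Rx′y′))
  ...   | inj₂ (there y′∈bs) = y′ , ∈-++⁺ʳ as y′∈bs , Rx′y′

length-cartesianProductWith : ∀ (f : X → Y → Z) xs ys →
  length (cartesianProductWith f xs ys) ≡ length xs * length ys
length-cartesianProductWith f []       ys = refl
length-cartesianProductWith f (x ∷ xs) ys = trans (length-++ (map (f x) ys))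
  (cong₂ _+_ (length-map (f x) ys) (length-cartesianProductWith f xs ys))

dependentPairs : List X → (X → List Y) → List (X × Y)
dependentPairs xs f = concatMap (λ x → map (x ,_) (f x)) xs

length-dependentPairs : ∀ xs (f : X → List Y) →
  length (dependentPairs xs f) ≡ sum (map (length ∘ f) xs)
length-dependentPairs []       f = refl
length-dependentPairs (x ∷ xs) f = trans (length-++ (map (x ,_) (f x)))
  (cong₂ _+_ (length-map (x ,_) (f x)) (length-dependentPairs xs f))

∈-dependentPairs⁺ : ∀ {xs} {f : X → List Y} {x y} → x ∈ xs → y ∈ f x → (x , y) ∈ dependentPairs xs f
∈-dependentPairs⁺ (here refl) y∈ = ∈-++⁺ˡ (∈-map⁺ _ y∈)
∈-dependentPairs⁺ {f = f} (there {x = x′} x∈) y∈ = ∈-++⁺ʳ (map (x′ ,_) (f x′)) (∈-dependentPairs⁺ x∈ y∈)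

∈-dependentPairs⁻ : ∀ xs {f : X → List Y} {x y} → (x , y) ∈ dependentPairs xs f → x ∈ xs × y ∈ f x
∈-dependentPairs⁻ (x ∷ xs) {f} p∈ with ∈-++⁻ (map (x ,_) (f x)) p∈
... | inj₁ p∈ˡ with _ , y∈ , refl ← ∈-map⁻ _ p∈ˡ = here refl , y∈
... | inj₂ p∈ʳ with x∈ , y∈ ← ∈-dependentPairs⁻ xs p∈ʳ = there x∈ , y∈

dependentPairs-unique : ∀ {xs} {f : X → List Y} → Unique xs → (∀ x → Unique (f x)) →
  Unique (dependentPairs xs f)
dependentPairs-unique [] _ = []
dependentPairs-unique {xs = x ∷ xs} {f} (x∉ ∷ u) uf =
  UniqueP.++⁺ (UniqueP.map⁺ (cong proj₂) (uf x)) (dependentPairs-unique u uf) disjoint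
  where
  disjoint : ∀ {p} → ¬ (p ∈ map (x ,_) (f x) × p ∈ dependentPairs xs f)
  disjoint (p∈ˡ , p∈ʳ) with _ , _ , refl ← ∈-map⁻ (x ,_) p∈ˡ =
    All.lookup x∉ (proj₁ (∈-dependentPairs⁻ xs p∈ʳ)) refl

-- Linear algebra over a finite field

module LinearAlgebra (F : FiniteField) where
  open FiniteField F renaming (_+_ to _+ᶠ_; _*_ to _*ᶠ_; -_ to -ᶠ_; _≟_ to _≟ᶠ_; order to q)

  𝔽 : CommutativeRing 0ℓ 0ℓ
  𝔽 = record { isCommutativeRing = isCommutativeRing }

  open CommutativeRing 𝔽 public using ()
    renaming ( +-assoc to ⊹-assoc; +-comm to ⊹-comm; +-identityˡ to ⊹-identityˡ; +-identityʳ to ⊹-identityʳ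
             ; *-assoc to ·-assoc; *-comm to ·-comm; *-identityˡ to ·-identityˡ; *-identityʳ to ·-identityʳ
             ; zeroˡ to ·-zeroˡ; zeroʳ to ·-zeroʳ; distribˡ to ·-distribˡ; distribʳ to ·-distribʳ
             ; -‿inverseˡ to ⊹-inverseˡ; -‿inverseʳ to ⊹-inverseʳ; +-commutativeSemigroup to ⊹-commutativeSemigroup )
  open RingP (CommutativeRing.ring 𝔽) using (-‿distribˡ-*; -‿distribʳ-*; -1*x≈-x; -‿involutive)
    renaming (+-inverseˡ-unique to inverseˡ-unique; +-inverseʳ-unique to inverseʳ-unique; +-cancelˡ to ⊹-cancelˡ)

  1<q : 1 < q
  1<q = length-injection _≡_ (0# ∷ 1# ∷ []) elements ((0≢1 ∷ []) ∷ [] ∷ []) (λ {x} _ → x , complete x , refl)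
    (λ { refl refl → refl })

  infixl 6 _⊕_
  infixl 7 _⊙_

  private variable
    k l m n : ℕ

  V : ℕ → Set
  V = Pt F

  _⊕_ : V n → V n → V n
  _⊕_ = _+V_ F

  _⊙_ : Carrier → V n → V n
  _⊙_ = _·V_ F

  𝟎 : V n
  𝟎 = zeroV F

  ⊖_ : V n → V n
  ⊖_ = Vec.map -ᶠ_

  Σᶠ : V n → Carrier
  Σᶠ = sumF F

  lc : V k → Vec (V n) k → V n
  lc = lincomb F

  _≟ⱽ_ : (x y : V n) → Dec (x ≡ y)
  _≟ⱽ_ = VecP.≡-dec _≟ᶠ_

  ⊕-assoc : (x y z : V n) → (x ⊕ y) ⊕ z ≡ x ⊕ (y ⊕ z)
  ⊕-assoc = VecP.zipWith-assoc ⊹-assoc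

  ⊕-comm : (x y : V n) → x ⊕ y ≡ y ⊕ x
  ⊕-comm = VecP.zipWith-comm ⊹-comm

  ⊕-identityˡ : (x : V n) → 𝟎 ⊕ x ≡ x
  ⊕-identityˡ = VecP.zipWith-identityˡ ⊹-identityˡ

  ⊕-identityʳ : (x : V n) → x ⊕ 𝟎 ≡ x
  ⊕-identityʳ = VecP.zipWith-identityʳ ⊹-identityʳ

  ⊕-inverseʳ : (x : V n) → x ⊕ (⊖ x) ≡ 𝟎
  ⊕-inverseʳ = VecP.zipWith-inverseʳ ⊹-inverseʳ

  ⊕-inverseˡ : (x : V n) → (⊖ x) ⊕ x ≡ 𝟎
  ⊕-inverseˡ = VecP.zipWith-inverseˡ ⊹-inverseˡ

  ⊕-cancelˡ : (x : V n) {y z : V n} → x ⊕ y ≡ x ⊕ z → y ≡ z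
  ⊕-cancelˡ x {y} {z} eq = begin
    y              ≡⟨ undo y ⟩
    ⊖ x ⊕ (x ⊕ y)  ≡⟨ cong (⊖ x ⊕_) eq ⟩
    ⊖ x ⊕ (x ⊕ z)  ≡⟨ undo z ⟨
    z              ∎
    where
    open ≡-Reasoning
    undo : ∀ w → w ≡ ⊖ x ⊕ (x ⊕ w)
    undo w = sym (trans (sym (⊕-assoc (⊖ x) x w)) (trans (cong (_⊕ w) (⊕-inverseˡ x)) (⊕-identityˡ w)))

  ⊕-cancelʳ : (x : V n) {y z : V n} → y ⊕ x ≡ z ⊕ x → y ≡ z
  ⊕-cancelʳ x {y} {z} eq = ⊕-cancelˡ x (trans (⊕-comm x y) (trans eq (⊕-comm z x)))

  ⊕-interchange : (w x y z : V n) → (w ⊕ x) ⊕ (y ⊕ z) ≡ (w ⊕ y) ⊕ (x ⊕ z)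
  ⊕-interchange {n} = CommutativeSemigroupP.interchange (record
    { Carrier = V n ; _∙_ = _⊕_ ; isCommutativeSemigroup = record
      { isSemigroup = record
        { isMagma = record { isEquivalence = isEquivalence ; ∙-cong = cong₂ _⊕_ }
        ; assoc = ⊕-assoc }
      ; comm = ⊕-comm } })

  ·-exchange : ∀ x y z → x *ᶠ (y *ᶠ z) ≡ y *ᶠ (x *ᶠ z)
  ·-exchange = CommutativeSemigroupP.x∙yz≈y∙xz (CommutativeRing.*-commutativeSemigroup 𝔽)

  ⊹-interchange : ∀ w x y z → (w +ᶠ x) +ᶠ (y +ᶠ z) ≡ (w +ᶠ y) +ᶠ (x +ᶠ z)
  ⊹-interchange = CommutativeSemigroupP.interchange ⊹-commutativeSemigroup

  ⊙-distribˡ : ∀ c (x y : V n) → c ⊙ (x ⊕ y) ≡ c ⊙ x ⊕ c ⊙ y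
  ⊙-distribˡ c []      []      = refl
  ⊙-distribˡ c (x ∷ v) (y ∷ w) = cong₂ _∷_ (·-distribˡ c x y) (⊙-distribˡ c v w)

  ⊙-distribʳ : ∀ c d (x : V n) → (c +ᶠ d) ⊙ x ≡ c ⊙ x ⊕ d ⊙ x
  ⊙-distribʳ c d []      = refl
  ⊙-distribʳ c d (x ∷ v) = cong₂ _∷_ (·-distribʳ x c d) (⊙-distribʳ c d v)

  ⊙-assoc : ∀ c d (x : V n) → (c *ᶠ d) ⊙ x ≡ c ⊙ (d ⊙ x)
  ⊙-assoc c d []      = refl
  ⊙-assoc c d (x ∷ v) = cong₂ _∷_ (·-assoc c d x) (⊙-assoc c d v)

  ⊙-zeroˡ : (x : V n) → 0# ⊙ x ≡ 𝟎
  ⊙-zeroˡ []      = refl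
  ⊙-zeroˡ (x ∷ v) = cong₂ _∷_ (·-zeroˡ x) (⊙-zeroˡ v)

  ⊙-zeroʳ : ∀ c → c ⊙ 𝟎 {n} ≡ 𝟎
  ⊙-zeroʳ {n} c = trans (VecP.map-replicate (c *ᶠ_) 0# n) (cong (Vec.replicate n) (·-zeroʳ c))

  ⊙-identityˡ : (x : V n) → 1# ⊙ x ≡ x
  ⊙-identityˡ []      = refl
  ⊙-identityˡ (x ∷ v) = cong₂ _∷_ (·-identityˡ x) (⊙-identityˡ v)

  Σᶠ-⊕ : (x y : V n) → Σᶠ (x ⊕ y) ≡ Σᶠ x +ᶠ Σᶠ y
  Σᶠ-⊕ []      []      = sym (⊹-identityˡ 0#)
  Σᶠ-⊕ (x ∷ v) (y ∷ w) rewrite Σᶠ-⊕ v w = ⊹-interchange x y (Σᶠ v) (Σᶠ w)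

  Σᶠ-⊙ : ∀ c (x : V n) → Σᶠ (c ⊙ x) ≡ c *ᶠ Σᶠ x
  Σᶠ-⊙ c []      = sym (·-zeroʳ c)
  Σᶠ-⊙ c (x ∷ v) rewrite Σᶠ-⊙ c v = sym (·-distribˡ c x (Σᶠ v))

  Σᶠ-𝟎 : ∀ n → Σᶠ (𝟎 {n}) ≡ 0#
  Σᶠ-𝟎 zero    = refl
  Σᶠ-𝟎 (suc n) = trans (⊹-identityˡ _) (Σᶠ-𝟎 n)

  lc-⊕ : (x y : V k) (S : Vec (V n) k) → lc (x ⊕ y) S ≡ lc x S ⊕ lc y S
  lc-⊕ []      []      []      = sym (⊕-identityˡ 𝟎)
  lc-⊕ (x ∷ v) (y ∷ w) (s ∷ S) rewrite lc-⊕ v w S | ⊙-distribʳ x y s =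
    ⊕-interchange (x ⊙ s) (y ⊙ s) (lc v S) (lc w S)

  lc-⊙ : ∀ c (x : V k) (S : Vec (V n) k) → lc (c ⊙ x) S ≡ c ⊙ lc x S
  lc-⊙ c []      []      = sym (⊙-zeroʳ c)
  lc-⊙ c (x ∷ v) (s ∷ S) rewrite lc-⊙ c v S | ⊙-assoc c x s = sym (⊙-distribˡ c (x ⊙ s) (lc v S))

  lc-𝟎 : (S : Vec (V n) k) → lc 𝟎 S ≡ 𝟎
  lc-𝟎 []      = refl
  lc-𝟎 (s ∷ S) rewrite lc-𝟎 S | ⊙-zeroˡ s = ⊕-identityˡ 𝟎

  record IsLinear (f : V m → V n) : Set where
    field
      additive    : ∀ x y → f (x ⊕ y) ≡ f x ⊕ f y
      homogeneous : ∀ c x → f (c ⊙ x) ≡ c ⊙ f x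

    preserves-𝟎 : f 𝟎 ≡ 𝟎
    preserves-𝟎 = trans (cong f (sym (⊙-zeroˡ 𝟎))) (trans (homogeneous 0# 𝟎) (⊙-zeroˡ (f 𝟎)))

  id-linear : IsLinear (id {A = V n})
  id-linear = record { additive = λ _ _ → refl ; homogeneous = λ _ _ → refl }

  take-linear : ∀ m → IsLinear (Vec.take m {n})
  take-linear m = record { additive = VecP.take-zipWith _+ᶠ_ ; homogeneous = λ c → VecP.take-map (c *ᶠ_) m }

  drop-linear : ∀ m → IsLinear (Vec.drop m {n})
  drop-linear m = record { additive = VecP.drop-zipWith _+ᶠ_ ; homogeneous = λ c → VecP.drop-map (c *ᶠ_) m }

  pts : ∀ n → List (V n)
  pts = allVecs F elements

  ∈-pts : (v : V n) → v ∈ pts n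
  ∈-pts []      = here refl
  ∈-pts (x ∷ v) = ∈-cartesianProductWith⁺ _∷_ (complete x) (∈-pts v)

  pts-unique : ∀ n → Unique (pts n)
  pts-unique zero    = [] ∷ []
  pts-unique (suc n) = UniqueP.cartesianProductWith⁺ _∷_ VecP.∷-injective distinct (pts-unique n)

  length-pts : ∀ n → length (pts n) ≡ q ^ n
  length-pts zero    = refl
  length-pts (suc n) = trans (length-cartesianProductWith _∷_ elements (pts n)) (cong (q *_) (length-pts n))

  dimension-≤ : (f : V k → V l) → (∀ {x y} → f x ≡ f y → x ≡ y) → k ≤ l
  dimension-≤ {k} {l} f f-injective = ≮⇒≥ λ l<k → <⇒≱ (^-monoʳ-< q 1<q l<k) (begin
    q ^ k          ≡⟨ length-pts k ⟨
    length (pts k) ≤⟨ length-injection (λ x y → f x ≡ y) (pts k) (pts l) (pts-unique k)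
                        (λ {x} _ → f x , ∈-pts (f x) , refl) (λ p r → f-injective (trans p (sym r))) ⟩
    length (pts l) ≡⟨ length-pts l ⟩
    q ^ l          ∎)
    where open ≤-Reasoning

  -- Affine spans, bases and rank

  InSpan : List (V n) → V n → Set
  InSpan S p = ∃ λ (c : V (length S)) → Σᶠ c ≡ 1# × lc c (Vec.fromList S) ≡ p

  InSpan-here : ∀ (b : V n) S → InSpan (b ∷ S) b
  InSpan-here b S = 1# ∷ 𝟎 , trans (cong (1# +ᶠ_) (Σᶠ-𝟎 (length S))) (⊹-identityʳ 1#)
    , trans (cong₂ _⊕_ (⊙-identityˡ b) (lc-𝟎 (Vec.fromList S))) (⊕-identityʳ b)

  InSpan-there : ∀ (b : V n) {S p} → InSpan S p → InSpan (b ∷ S) p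
  InSpan-there b (c , Σc≡1 , lc≡p) = 0# ∷ c , trans (⊹-identityˡ _) Σc≡1
    , trans (cong₂ _⊕_ (⊙-zeroˡ b) lc≡p) (⊕-identityˡ _)

  private
    cancel : ∀ {c d b w} → c *ᶠ d ≡ 1# → c *ᶠ b +ᶠ w ≡ 0# → (-ᶠ d) *ᶠ w ≡ b
    cancel {c} {d} {b} {w} cd≡1 eq = begin
      (-ᶠ d) *ᶠ w                ≡⟨ cong ((-ᶠ d) *ᶠ_) (inverseʳ-unique _ _ eq) ⟩
      (-ᶠ d) *ᶠ (-ᶠ (c *ᶠ b))    ≡⟨ -‿distribˡ-* d _ ⟨
      -ᶠ (d *ᶠ (-ᶠ (c *ᶠ b)))    ≡⟨ cong -ᶠ_ (-‿distribʳ-* d _) ⟨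
      -ᶠ (-ᶠ (d *ᶠ (c *ᶠ b)))    ≡⟨ -‿involutive _ ⟩
      d *ᶠ (c *ᶠ b)              ≡⟨ ·-assoc d c b ⟨
      (d *ᶠ c) *ᶠ b              ≡⟨ cong (_*ᶠ b) (trans (·-comm d c) cd≡1) ⟩
      1# *ᶠ b                    ≡⟨ ·-identityˡ b ⟩
      b                          ∎
      where open ≡-Reasoning

    cancelⱽ : ∀ {c d} {b w : V n} → c *ᶠ d ≡ 1# → c ⊙ b ⊕ w ≡ 𝟎 → (-ᶠ d) ⊙ w ≡ b
    cancelⱽ {b = []}    {[]}    _    _  = refl
    cancelⱽ {b = x ∷ b} {y ∷ w} cd≡1 eq with eq₁ , eq₂ ← VecP.∷-injective eq =
      cong₂ _∷_ (cancel cd≡1 eq₁) (cancelⱽ cd≡1 eq₂)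

    differenceⱽ : (x y : V n) → x ⊕ (-ᶠ 1#) ⊙ y ≡ 𝟎 → x ≡ y
    differenceⱽ []      []      _  = refl
    differenceⱽ (x ∷ v) (y ∷ w) eq with eq₁ , eq₂ ← VecP.∷-injective eq = cong₂ _∷_
      (trans (inverseˡ-unique x _ eq₁) (trans (cong -ᶠ_ (-1*x≈-x y)) (-‿involutive y)))
      (differenceⱽ v w eq₂)

    x⊕-x : (x : V n) → x ⊕ (-ᶠ 1#) ⊙ x ≡ 𝟎
    x⊕-x []      = refl
    x⊕-x (x ∷ v) = cong₂ _∷_ (trans (cong (x +ᶠ_) (-1*x≈-x x)) (⊹-inverseʳ x)) (x⊕-x v)

  -- There are finitely many coefficient vectors, so a nontrivial relation on `b ∷ S` can be
  -- searched for. In such a relation the coefficient of b is nonzero, since S is independent, and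
  -- the relation can be solved for b.
  AffIndep-extend : ∀ (b : V n) {S} → AffIndep F S → AffIndep F (b ∷ S) ⊎ InSpan S b
  AffIndep-extend b {S} indep with Any.any? relation? (pts (suc (length S)))
    where
    Sᵛ = Vec.fromList S
    relation? : ∀ c → Dec (Σᶠ c ≡ 0# × lc c (b ∷ Sᵛ) ≡ 𝟎 × ¬ c ≡ 𝟎)
    relation? c = (Σᶠ c ≟ᶠ 0#) ×-dec (lc c (b ∷ Sᵛ) ≟ⱽ 𝟎) ×-dec ¬? (c ≟ⱽ 𝟎)
  ... | no none = inj₁ trivial
    where
    trivial : AffIndep F (b ∷ S)
    trivial c Σc≡0 lc≡𝟎 with c ≟ⱽ 𝟎
    ... | yes c≡𝟎 = c≡𝟎
    ... | no  c≢𝟎 = ⊥-elim (none (Any.map (λ { refl → Σc≡0 , lc≡𝟎 , c≢𝟎 }) (∈-pts c)))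
  ... | yes some with Any.satisfied some
  ...   | c₀ ∷ c , Σc≡0 , lc≡𝟎 , c≢𝟎 with c₀ ≟ᶠ 0#
  ...     | yes refl = ⊥-elim (c≢𝟎 (cong (0# ∷_) (indep c
              (trans (sym (⊹-identityˡ _)) Σc≡0)
              (trans (sym (⊕-identityˡ _)) (trans (cong (_⊕ lc c (Vec.fromList S)) (sym (⊙-zeroˡ b))) lc≡𝟎)))))
  -- Solving for b multiplies the other coefficients by -d. That they then sum to 1 is the same
  -- cancellation, applied to the sum of the coefficients with 1 in place of b.
  ...     | no c₀≢0 with d , c₀d≡1 ← inverse c₀ c₀≢0 = inj₂
              ( (-ᶠ d) ⊙ c
              , trans (Σᶠ-⊙ (-ᶠ d) c) (cancel c₀d≡1 (trans (cong (_+ᶠ Σᶠ c) (·-identityʳ c₀)) Σc≡0))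
              , trans (lc-⊙ (-ᶠ d) c (Vec.fromList S)) (cancelⱽ c₀d≡1 lc≡𝟎))

  record AffBasis (B : List (V n)) : Set where
    field
      basis    : List (V n)
      basis⊆   : basis ⊆ B
      indep    : AffIndep F basis
      spanning : ∀ {b} → b ∈ B → InSpan basis b

  affBasis : (B : List (V n)) → AffBasis B
  affBasis []      = record
    { basis = [] ; basis⊆ = [] ; indep = λ { [] _ _ → refl } ; spanning = λ () }
  affBasis (b ∷ B) with affBasis B
  ... | record { basis = S ; basis⊆ = S⊆B ; indep = indep ; spanning = spanning } with AffIndep-extend b indep
  ...   | inj₁ indep′ = record
    { basis = b ∷ S ; basis⊆ = refl ∷ S⊆B ; indep = indep′
    ; spanning = λ { (here refl) → InSpan-here b S ; (there b′∈) → InSpan-there b (spanning b′∈) } }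
  ...   | inj₂ b∈span = record
    { basis = S ; basis⊆ = b ∷ʳ S⊆B ; indep = indep
    ; spanning = λ { (here refl) → b∈span ; (there b′∈) → spanning b′∈ } }

  -- The difference of x and y is an affine relation on T. It is written with the scalar -1, so that
  -- linearity of `Σᶠ` and `lc` applies to it.
  indep-injective : ∀ {T : List (V n)} → AffIndep F T → ∀ x y → Σᶠ x ≡ Σᶠ y →
    lc x (Vec.fromList T) ≡ lc y (Vec.fromList T) → x ≡ y
  indep-injective {T = T} indep x y Σ≡ lc≡ = differenceⱽ x y (indep (x ⊕ (-ᶠ 1#) ⊙ y)
    (begin
      Σᶠ (x ⊕ (-ᶠ 1#) ⊙ y)          ≡⟨ Σᶠ-⊕ x _ ⟩
      Σᶠ x +ᶠ Σᶠ ((-ᶠ 1#) ⊙ y)      ≡⟨ cong₂ _+ᶠ_ Σ≡ (trans (Σᶠ-⊙ (-ᶠ 1#) y) (-1*x≈-x _)) ⟩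
      Σᶠ y +ᶠ (-ᶠ Σᶠ y)             ≡⟨ ⊹-inverseʳ (Σᶠ y) ⟩
      0#                            ∎)
    (begin
      lc (x ⊕ (-ᶠ 1#) ⊙ y) Tᵛ        ≡⟨ lc-⊕ x _ Tᵛ ⟩
      lc x Tᵛ ⊕ lc ((-ᶠ 1#) ⊙ y) Tᵛ  ≡⟨ cong₂ _⊕_ lc≡ (lc-⊙ (-ᶠ 1#) y Tᵛ) ⟩
      lc y Tᵛ ⊕ (-ᶠ 1#) ⊙ lc y Tᵛ    ≡⟨ x⊕-x (lc y Tᵛ) ⟩
      𝟎                              ∎))
    where
    open ≡-Reasoning
    Tᵛ = Vec.fromList T

  -- Row j of Λ expresses the image of the j-th point of T as an affine combination of S.
  coordinates : {g : V m → V n} → IsLinear g → ∀ S T → (∀ {p} → p ∈ T → InSpan S (g p)) →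
    ∃ λ (Λ : Vec (V (length S)) (length T)) → ∀ x →
      Σᶠ (lc x Λ) ≡ Σᶠ x × g (lc x (Vec.fromList T)) ≡ lc (lc x Λ) (Vec.fromList S)
  coordinates g-lin S [] _ = [] , λ { [] → Σᶠ-𝟎 (length S) , trans preserves-𝟎 (sym (lc-𝟎 (Vec.fromList S))) }
    where open IsLinear g-lin
  coordinates {g = g} g-lin S (p ∷ T) span
    with c , Σc≡1 , lc≡gp ← span (here refl) | Λ , Λ-ok ← coordinates g-lin S T (span ∘ there) =
    c ∷ Λ , λ { (x ∷ xs) →
      (begin
        Σᶠ (x ⊙ c ⊕ lc xs Λ)        ≡⟨ Σᶠ-⊕ (x ⊙ c) _ ⟩
        Σᶠ (x ⊙ c) +ᶠ Σᶠ (lc xs Λ)  ≡⟨ cong₂ _+ᶠ_ (trans (Σᶠ-⊙ x c) (trans (cong (x *ᶠ_) Σc≡1) (·-identityʳ x))) (proj₁ (Λ-ok xs)) ⟩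
        x +ᶠ Σᶠ xs                  ∎) ,
      (begin
        g (x ⊙ p ⊕ lc xs Tᵛ)        ≡⟨ additive (x ⊙ p) _ ⟩
        g (x ⊙ p) ⊕ g (lc xs Tᵛ)    ≡⟨ cong₂ _⊕_ (trans (homogeneous x p) (cong (x ⊙_) (sym lc≡gp))) (proj₂ (Λ-ok xs)) ⟩
        x ⊙ lc c Sᵛ ⊕ lc (lc xs Λ) Sᵛ ≡⟨ cong (_⊕ lc (lc xs Λ) Sᵛ) (lc-⊙ x c Sᵛ) ⟨
        lc (x ⊙ c) Sᵛ ⊕ lc (lc xs Λ) Sᵛ ≡⟨ lc-⊕ (x ⊙ c) _ Sᵛ ⟨
        lc (x ⊙ c ⊕ lc xs Λ) Sᵛ     ∎) }
    where
    open ≡-Reasoning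
    open IsLinear g-lin
    Sᵛ = Vec.fromList S
    Tᵛ = Vec.fromList T

  -- The coordinates of a combination of T with respect to S determine both its coefficient sum and
  -- its value. By independence of T they determine the combination, so the coordinate map is
  -- injective.
  indep-length-≤ : ∀ (S T : List (V n)) → AffIndep F T → (∀ {p} → p ∈ T → InSpan S p) → length T ≤ length S
  indep-length-≤ S T indep span with Λ , Λ-ok ← coordinates id-linear S T span =
    dimension-≤ (λ x → lc x Λ) λ {x} {y} eq → indep-injective indep x y
      (trans (sym (proj₁ (Λ-ok x))) (trans (cong Σᶠ eq) (proj₁ (Λ-ok y))))
      (trans (proj₂ (Λ-ok x)) (trans (cong (λ z → lc z (Vec.fromList S)) eq) (sym (proj₂ (Λ-ok y)))))

  affBasis-rank : ∀ {B : List (V n)} (β : AffBasis B) → IsAffRank F B (length (AffBasis.basis β))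
  affBasis-rank β = (basis , basis⊆ , indep , refl) , λ T T⊆B T-indep →
    indep-length-≤ basis T T-indep (λ p∈T → spanning (lookup T⊆B p∈T))
    where open AffBasis β

  -- The pair of coordinate vectors has equal sums, so adding c ⊙ e with Σᶠ e ≡ 1# to one of them
  -- leaves both c and the relation recoverable: this accounts for the extra dimension.
  indep-product-length-< : ∀ (S₁ : List (V m)) (S₂ : List (V n)) T → AffIndep F T →
    (∀ {p} → p ∈ T → InSpan S₁ (Vec.take m p) × InSpan S₂ (Vec.drop m p)) →
    (e : V (length S₂)) → Σᶠ e ≡ 1# → length T < length S₁ + length S₂
  indep-product-length-< {m} S₁ S₂ T indep span e Σe≡1
    with Λ₁ , ok₁ ← coordinates (take-linear m) S₁ T (proj₁ ∘ span)
       | Λ₂ , ok₂ ← coordinates (drop-linear m) S₂ T (proj₂ ∘ span) = dimension-≤ f f-injective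
    where
    f : V (suc (length T)) → V (length S₁ + length S₂)
    f (c ∷ x) = lc x Λ₁ Vec.++ (lc x Λ₂ ⊕ c ⊙ e)
    Σ₂ : ∀ c x → Σᶠ (lc x Λ₂ ⊕ c ⊙ e) ≡ Σᶠ x +ᶠ c
    Σ₂ c x = trans (Σᶠ-⊕ (lc x Λ₂) (c ⊙ e))
      (cong₂ _+ᶠ_ (proj₁ (ok₂ x)) (trans (Σᶠ-⊙ c e) (trans (cong (c *ᶠ_) Σe≡1) (·-identityʳ c))))
    f-injective : ∀ {x y} → f x ≡ f y → x ≡ y
    f-injective {c ∷ x} {d ∷ y} eq with eq₁ , eq₂ ← VecP.++-injective (lc x Λ₁) (lc y Λ₁) eq =
      cong₂ _∷_ c≡d (indep-injective indep x y Σx≡Σy lc≡)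
      where
      Σx≡Σy : Σᶠ x ≡ Σᶠ y
      Σx≡Σy = trans (sym (proj₁ (ok₁ x))) (trans (cong Σᶠ eq₁) (proj₁ (ok₁ y)))
      c≡d : c ≡ d
      c≡d = ⊹-cancelˡ (Σᶠ x) c d (trans (sym (Σ₂ c x)) (trans (cong Σᶠ eq₂)
        (trans (Σ₂ d y) (cong (_+ᶠ d) (sym Σx≡Σy)))))
      eq₂′ : lc x Λ₂ ≡ lc y Λ₂
      eq₂′ = ⊕-cancelʳ (c ⊙ e) (trans eq₂ (cong (λ z → lc y Λ₂ ⊕ z ⊙ e) (sym c≡d)))
      Tᵛ = Vec.fromList T
      lc≡ : lc x Tᵛ ≡ lc y Tᵛ
      lc≡ = begin
        lc x Tᵛ                                        ≡⟨ VecP.take++drop≡id m _ ⟨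
        Vec.take m (lc x Tᵛ) Vec.++ Vec.drop m (lc x Tᵛ) ≡⟨ cong₂ Vec._++_
          (trans (proj₂ (ok₁ x)) (trans (cong (λ z → lc z (Vec.fromList S₁)) eq₁) (sym (proj₂ (ok₁ y)))))
          (trans (proj₂ (ok₂ x)) (trans (cong (λ z → lc z (Vec.fromList S₂)) eq₂′) (sym (proj₂ (ok₂ y))))) ⟩
        Vec.take m (lc y Tᵛ) Vec.++ Vec.drop m (lc y Tᵛ) ≡⟨ VecP.take++drop≡id m _ ⟩
        lc y Tᵛ                                        ∎
        where open ≡-Reasoning

cartesianProductWith-map : ∀ {X′ Y′ Z′ : Set} {_∙_ : X → Y → Z} {_∘′_ : X′ → Y′ → Z′}
  {f : X → X′} {g : Y → Y′} {h : Z → Z′} → (∀ x y → h (x ∙ y) ≡ f x ∘′ g y) → ∀ xs ys →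
  cartesianProductWith _∘′_ (map f xs) (map g ys) ≡ map h (cartesianProductWith _∙_ xs ys)
cartesianProductWith-map h≡ []       ys = refl
cartesianProductWith-map {_∙_ = _∙_} {_∘′_} {f} {g} {h} h≡ (x ∷ xs) ys = trans
  (cong₂ _++_
    (trans (sym (map-∘ ys)) (trans (map-cong (λ y → sym (h≡ x y)) ys) (map-∘ ys)))
    (cartesianProductWith-map h≡ xs ys))
  (sym (map-++ h (map (x ∙_) ys) _))

-- Here α is |A| itself, W is the sum of all |A_t|, H counts the homomorphisms of the product and K
-- the maps t. The first inequality is raised to the power a₂ and the second to b₁, so that W occurs
-- with exponent b₁ a₂ in both and can be eliminated.
power-combine : ∀ {α N W H K r r₁ r₂ a₁} b₁ b₂ e .{{_ : NonZero N}} →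
  α ^ a₁ * N ^ (r₁ * b₁) ≤ W ^ b₁ * N ^ a₁ →
  N ^ (r₂ * b₂) * W ^ (b₂ + e) ≤ N ^ (b₂ + e) * (H ^ b₂ * K ^ e) →
  K * N ≤ N ^ r₁ → r < r₁ + r₂ →
  α ^ (a₁ * (b₂ + e)) * N ^ (r * (b₁ * b₂)) ≤ H ^ (b₁ * b₂) * N ^ (a₁ * (b₂ + e))
power-combine {α} {N} {W} {H} {K} {r} {r₁} {r₂} {a₁} b₁ b₂ e α≤W W≤H KN≤ r<r₁+r₂ =
  *-cancelʳ-≤ _ _ (N ^ s) {{m^n≢0 N s}} (begin
    α ^ (a₁ * a₂) * N ^ (r * (b₁ * b₂)) * N ^ s          ≡⟨ *-assoc (α ^ (a₁ * a₂)) _ _ ⟩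
    α ^ (a₁ * a₂) * (N ^ (r * (b₁ * b₂)) * N ^ s)        ≡⟨ cong (α ^ (a₁ * a₂) *_) (^-distribˡ-+-* N (r * (b₁ * b₂)) s) ⟨
    α ^ (a₁ * a₂) * N ^ (r * (b₁ * b₂) + s)              ≤⟨ *-monoʳ-≤ (α ^ (a₁ * a₂)) (^-monoʳ-≤ N exponents) ⟩
    α ^ (a₁ * a₂) * N ^ (r₁ * b₁ * a₂ + r₂ * b₂ * b₁)    ≡⟨ cong (α ^ (a₁ * a₂) *_) (^-distribˡ-+-* N (r₁ * b₁ * a₂) _) ⟩
    α ^ (a₁ * a₂) * (N ^ (r₁ * b₁ * a₂) * N ^ (r₂ * b₂ * b₁)) ≡⟨ *-assoc (α ^ (a₁ * a₂)) _ _ ⟨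
    α ^ (a₁ * a₂) * N ^ (r₁ * b₁ * a₂) * N ^ (r₂ * b₂ * b₁) ≡⟨ cong₂ _*_
        (product-power a₂ α a₁ N (r₁ * b₁)) (^-*-assoc N (r₂ * b₂) b₁) ⟨
    (α ^ a₁ * N ^ (r₁ * b₁)) ^ a₂ * (N ^ (r₂ * b₂)) ^ b₁ ≤⟨ *-monoˡ-≤ _ (^-monoˡ-≤ a₂ α≤W) ⟩
    (W ^ b₁ * N ^ a₁) ^ a₂ * (N ^ (r₂ * b₂)) ^ b₁        ≡⟨ cong (_* (N ^ (r₂ * b₂)) ^ b₁) (trans (product-power a₂ W b₁ N a₁)
        (cong (_* N ^ (a₁ * a₂)) (trans (cong (W ^_) (*-comm b₁ a₂)) (sym (^-*-assoc W a₂ b₁))))) ⟩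
    (W ^ a₂) ^ b₁ * N ^ (a₁ * a₂) * (N ^ (r₂ * b₂)) ^ b₁ ≡⟨ rotate ((W ^ a₂) ^ b₁) (N ^ (a₁ * a₂)) ((N ^ (r₂ * b₂)) ^ b₁) ⟩
    N ^ (a₁ * a₂) * ((N ^ (r₂ * b₂)) ^ b₁ * (W ^ a₂) ^ b₁) ≡⟨ cong (N ^ (a₁ * a₂) *_) (^-distribʳ-* b₁ (N ^ (r₂ * b₂)) (W ^ a₂)) ⟨
    N ^ (a₁ * a₂) * (N ^ (r₂ * b₂) * W ^ a₂) ^ b₁        ≤⟨ *-monoʳ-≤ (N ^ (a₁ * a₂)) (^-monoˡ-≤ b₁ W≤H) ⟩
    -- Of the a₂ = b₂ + e factors N, e are paired with the factors K, in order to use the bound on K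
    -- N.
    N ^ (a₁ * a₂) * (N ^ a₂ * (H ^ b₂ * K ^ e)) ^ b₁     ≡⟨ cong (λ z → N ^ (a₁ * a₂) * z ^ b₁) regroup ⟩
    N ^ (a₁ * a₂) * (H ^ b₂ * (N ^ b₂ * (K * N) ^ e)) ^ b₁ ≤⟨ *-monoʳ-≤ (N ^ (a₁ * a₂)) (^-monoˡ-≤ b₁
        (*-monoʳ-≤ (H ^ b₂) (*-monoʳ-≤ (N ^ b₂) (^-monoˡ-≤ e KN≤)))) ⟩
    N ^ (a₁ * a₂) * (H ^ b₂ * (N ^ b₂ * (N ^ r₁) ^ e)) ^ b₁ ≡⟨ cong (λ z → N ^ (a₁ * a₂) * (H ^ b₂ * z) ^ b₁)
        (trans (cong (N ^ b₂ *_) (^-*-assoc N r₁ e)) (sym (^-distribˡ-+-* N b₂ (r₁ * e)))) ⟩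
    N ^ (a₁ * a₂) * (H ^ b₂ * N ^ (b₂ + r₁ * e)) ^ b₁    ≡⟨ cong (N ^ (a₁ * a₂) *_) (product-power b₁ H b₂ N (b₂ + r₁ * e)) ⟩
    N ^ (a₁ * a₂) * (H ^ (b₂ * b₁) * N ^ s)              ≡⟨ exchange (N ^ (a₁ * a₂)) (H ^ (b₂ * b₁)) (N ^ s) ⟩
    H ^ (b₂ * b₁) * N ^ (a₁ * a₂) * N ^ s                ≡⟨ cong (λ z → H ^ z * N ^ (a₁ * a₂) * N ^ s) (*-comm b₂ b₁) ⟩
    H ^ (b₁ * b₂) * N ^ (a₁ * a₂) * N ^ s                ∎)
  where
  open ≤-Reasoning
  a₂ = b₂ + e
  -- The surplus power of N on the right once K N has been replaced by N^r₁; it is cancelled at the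
  -- end.
  s = (b₂ + r₁ * e) * b₁
  product-power : ∀ k x i y j → (x ^ i * y ^ j) ^ k ≡ x ^ (i * k) * y ^ (j * k)
  product-power k x i y j = trans (^-distribʳ-* k (x ^ i) (y ^ j)) (cong₂ _*_ (^-*-assoc x i k) (^-*-assoc y j k))
  rotate : ∀ x y z → x * y * z ≡ y * (z * x)
  rotate = solve-∀
  exchange : ∀ x y z → x * (y * z) ≡ y * x * z
  exchange = solve-∀
  regroup : N ^ a₂ * (H ^ b₂ * K ^ e) ≡ H ^ b₂ * (N ^ b₂ * (K * N) ^ e)
  regroup = trans (cong (_* (H ^ b₂ * K ^ e)) (^-distribˡ-+-* N b₂ e))
    (trans (perm (N ^ b₂) (N ^ e) (H ^ b₂) (K ^ e)) (cong (λ z → H ^ b₂ * (N ^ b₂ * z)) (sym (^-distribʳ-* e K N))))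
    where
    perm : ∀ x y z w → x * y * (z * w) ≡ z * (x * (w * y))
    perm = solve-∀
  -- After removal of r₁ e b₁ from both sides this is (r + 1) b₁ b₂ ≤ (r₁ + r₂) b₁ b₂: the unit
  -- gained in the rank inequality pays for the summand b₂ b₁ of s.
  exponents : r * (b₁ * b₂) + s ≤ r₁ * b₁ * a₂ + r₂ * b₂ * b₁
  exponents = begin
    r * (b₁ * b₂) + s                          ≡⟨ lhs r b₁ b₂ r₁ e ⟩
    suc r * (b₁ * b₂) + r₁ * e * b₁            ≤⟨ +-monoˡ-≤ (r₁ * e * b₁) (*-monoˡ-≤ (b₁ * b₂) r<r₁+r₂) ⟩
    (r₁ + r₂) * (b₁ * b₂) + r₁ * e * b₁        ≡⟨ rhs r₁ r₂ b₁ b₂ e ⟩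
    r₁ * b₁ * a₂ + r₂ * b₂ * b₁                ∎
    where
    lhs : ∀ r b₁ b₂ r₁ e → r * (b₁ * b₂) + (b₂ + r₁ * e) * b₁ ≡ suc r * (b₁ * b₂) + r₁ * e * b₁
    lhs = solve-∀
    rhs : ∀ r₁ r₂ b₁ b₂ e → (r₁ + r₂) * (b₁ * b₂) + r₁ * e * b₁ ≡ r₁ * b₁ * (b₂ + e) + r₂ * b₂ * b₁
    rhs = solve-∀

-- Counting affine homomorphisms

module Homomorphisms (F : FiniteField) where
  open LinearAlgebra F
  open FiniteField F using (Carrier)
    renaming (_+_ to _+ᶠ_; _*_ to _*ᶠ_; order to q)

  private variable
    m m₁ m₂ n : ℕ

  applyAff′ : AffMap F m n → V m → V n
  applyAff′ = applyAff F

  dot-⊕ : (c x y : V m) → dot F c (x ⊕ y) ≡ dot F c x +ᶠ dot F c y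
  dot-⊕ c x y = trans (cong Σᶠ (VecP.zipWith-distribˡ ·-distribˡ c x y))
    (Σᶠ-⊕ (Vec.zipWith _*ᶠ_ c x) (Vec.zipWith _*ᶠ_ c y))

  dot-⊙ : ∀ d (c x : V m) → dot F c (d ⊙ x) ≡ d *ᶠ dot F c x
  dot-⊙ d c x = trans (cong Σᶠ (pull c x)) (Σᶠ-⊙ d (Vec.zipWith _*ᶠ_ c x))
    where
    pull : ∀ {m} (c x : V m) → Vec.zipWith _*ᶠ_ c (d ⊙ x) ≡ d ⊙ Vec.zipWith _*ᶠ_ c x
    pull []      []      = refl
    pull (c ∷ v) (x ∷ w) = cong₂ _∷_ (·-exchange c d x) (pull v w)

  dot-++ : (c x : V m₁) (d y : V m₂) → dot F (c Vec.++ d) (x Vec.++ y) ≡ dot F c x +ᶠ dot F d y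
  dot-++ []      []      d y = sym (⊹-identityˡ _)
  dot-++ (c ∷ v) (x ∷ w) d y = trans (cong ((c *ᶠ x) +ᶠ_) (dot-++ v w d y)) (sym (⊹-assoc _ _ _))

  linearPart : Vec (V m) n → V m → V n
  linearPart M x = Vec.map (λ row → dot F row x) M

  linearPart-linear : (M : Vec (V m) n) → IsLinear (linearPart M)
  linearPart-linear M = record { additive = additive M ; homogeneous = homogeneous M }
    where
    additive : ∀ {m n} (M : Vec (V m) n) x y → linearPart M (x ⊕ y) ≡ linearPart M x ⊕ linearPart M y
    additive []      x y = refl
    additive (c ∷ M) x y = cong₂ _∷_ (dot-⊕ c x y) (additive M x y)
    homogeneous : ∀ {m n} (M : Vec (V m) n) d x → linearPart M (d ⊙ x) ≡ d ⊙ linearPart M x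
    homogeneous []      d x = refl
    homogeneous (c ∷ M) d x = cong₂ _∷_ (dot-⊙ d c x) (homogeneous M d x)

  -- Affine maps commute with combinations of coefficient sum 1, but the tail of such a combination
  -- has another sum. The induction therefore runs over all sums, with the translation part weighted
  -- by the sum.
  applyAff-lc : ∀ (L : AffMap F m n) {k} (c : V k) S →
    linearPart (proj₁ L) (lc c S) ⊕ Σᶠ c ⊙ proj₂ L ≡ lc c (Vec.map (applyAff′ L) S)
  applyAff-lc (M , w) []      []      =
    trans (cong₂ _⊕_ (IsLinear.preserves-𝟎 (linearPart-linear M)) (⊙-zeroˡ w)) (⊕-identityˡ 𝟎)
  applyAff-lc (M , w) (c ∷ v) (s ∷ S) = begin
    ℓ (c ⊙ s ⊕ lc v S) ⊕ (c +ᶠ Σᶠ v) ⊙ w           ≡⟨ cong₂ _⊕_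
      (trans (additive _ _) (cong (_⊕ ℓ (lc v S)) (homogeneous c s))) (⊙-distribʳ c (Σᶠ v) w) ⟩
    (c ⊙ ℓ s ⊕ ℓ (lc v S)) ⊕ (c ⊙ w ⊕ Σᶠ v ⊙ w)    ≡⟨ ⊕-interchange (c ⊙ ℓ s) (ℓ (lc v S)) (c ⊙ w) (Σᶠ v ⊙ w) ⟩
    (c ⊙ ℓ s ⊕ c ⊙ w) ⊕ (ℓ (lc v S) ⊕ Σᶠ v ⊙ w)    ≡⟨ cong₂ _⊕_ (sym (⊙-distribˡ c (ℓ s) w)) (applyAff-lc (M , w) v S) ⟩
    c ⊙ (ℓ s ⊕ w) ⊕ lc v (Vec.map (applyAff′ (M , w)) S) ∎
    where
    open ≡-Reasoning
    ℓ = linearPart M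
    open IsLinear (linearPart-linear M)

  applyAff-span : ∀ (L : AffMap F m n) S {b} ((c , _) : InSpan S b) →
    applyAff′ L b ≡ lc c (Vec.map (applyAff′ L) (Vec.fromList S))
  applyAff-span L@(M , w) S (c , Σc≡1 , refl) = trans
    (cong (linearPart M (lc c (Vec.fromList S)) ⊕_) (sym (trans (cong (_⊙ w) Σc≡1) (⊙-identityˡ w))))
    (applyAff-lc L c (Vec.fromList S))

  agree-on-span : ∀ {L L′ : AffMap F m n} {S b} → map (applyAff′ L) S ≡ map (applyAff′ L′) S →
    InSpan S b → applyAff′ L b ≡ applyAff′ L′ b
  agree-on-span {L = L} {L′} {S} eq b∈ = trans (applyAff-span L S b∈)
    (trans (cong (lc (proj₁ b∈)) (agree S eq)) (sym (applyAff-span L′ S b∈)))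
    where
    agree : ∀ S → map (applyAff′ L) S ≡ map (applyAff′ L′) S →
      Vec.map (applyAff′ L) (Vec.fromList S) ≡ Vec.map (applyAff′ L′) (Vec.fromList S)
    agree []      _  = refl
    agree (s ∷ S) eq with eq₁ , eq₂ ← ∷-injective eq = cong₂ _∷_ eq₁ (agree S eq₂)

  IsHom : List (V m) → List (V n) → Set
  IsHom B t = ∃ λ L → t ≡ map (applyAff′ L) B

  translate : V n → List (V n) → List (V n)
  translate u = map (_⊕ u)

  IsHom-translate : ∀ {B : List (V m)} {t : List (V n)} u → IsHom B t → IsHom B (translate u t)
  IsHom-translate {B = B} u ((M , w) , refl) = (M , w ⊕ u) ,
    trans (sym (map-∘ B)) (map-cong (λ b → ⊕-assoc (linearPart M b) w u) B)

  IsHom-length : ∀ {B : List (V m)} {t : List (V n)} → IsHom B t → length t ≡ length B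
  IsHom-length {B = B} (L , refl) = length-map (applyAff′ L) B

  -- Joining the two matrices row by row gives the affine map that sends `x ++ y` to the sum of the
  -- two images. The list of sums follows the order in which `_×ᴮ_` enumerates the product.
  IsHom-× : ∀ {B₁ : List (V m₁)} {B₂ : List (V m₂)} {t s : List (V n)} → IsHom B₁ t → IsHom B₂ s →
    IsHom (_×ᴮ_ F B₁ B₂) (cartesianProductWith _⊕_ t s)
  IsHom-× {B₁ = B₁} {B₂} ((M₁ , w₁) , refl) ((M₂ , w₂) , refl) =
    (Vec.zipWith Vec._++_ M₁ M₂ , w₁ ⊕ w₂) , cartesianProductWith-map split B₁ B₂
    where
    split-linear : ∀ {m₁ m₂ n} (M₁ : Vec (V m₁) n) (M₂ : Vec (V m₂) n) x y →
      linearPart (Vec.zipWith Vec._++_ M₁ M₂) (x Vec.++ y) ≡ linearPart M₁ x ⊕ linearPart M₂ y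
    split-linear []       []       x y = refl
    split-linear (c ∷ M₁) (d ∷ M₂) x y = cong₂ _∷_ (dot-++ c x d y) (split-linear M₁ M₂ x y)
    split : ∀ x y → applyAff′ (Vec.zipWith Vec._++_ M₁ M₂ , w₁ ⊕ w₂) (x Vec.++ y)
      ≡ applyAff′ (M₁ , w₁) x ⊕ applyAff′ (M₂ , w₂) y
    split x y = trans (cong (_⊕ (w₁ ⊕ w₂)) (split-linear M₁ M₂ x y)) (⊕-interchange _ _ w₁ w₂)

  ∈-allTuples⁺ : ∀ {xs t : List X} → All (_∈ xs) t → t ∈ allTuples F xs (length t)
  ∈-allTuples⁺ []         = here refl
  ∈-allTuples⁺ (x∈ ∷ t∈) = ∈-cartesianProductWith⁺ _∷_ x∈ (∈-allTuples⁺ t∈)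

  ∈-allTuples⁻ : ∀ {xs t : List X} k → t ∈ allTuples F xs k → All (_∈ xs) t
  ∈-allTuples⁻ zero (here refl) = []
  ∈-allTuples⁻ {xs = xs} (suc k) t∈
    with x , t′ , x∈ , t′∈ , refl ← ∈-cartesianProductWith⁻ _∷_ xs (allTuples F xs k) t∈ =
    x∈ ∷ ∈-allTuples⁻ k t′∈

  allTuples-unique : ∀ {xs : List X} → Unique xs → ∀ k → Unique (allTuples F xs k)
  allTuples-unique u zero    = [] ∷ []
  allTuples-unique u (suc k) = UniqueP.cartesianProductWith⁺ _∷_ ∷-injective u (allTuples-unique u k)

  length-allTuples : ∀ (xs : List X) k → length (allTuples F xs k) ≡ length xs ^ k
  length-allTuples xs zero    = refl
  length-allTuples xs (suc k) = trans (length-cartesianProductWith _∷_ xs _) (cong (length xs *_) (length-allTuples xs k))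

  ∈-allVecs : ∀ {xs : List X} → (∀ x → x ∈ xs) → (v : Vec X n) → v ∈ allVecs F xs n
  ∈-allVecs all []      = here refl
  ∈-allVecs all (x ∷ v) = ∈-cartesianProductWith⁺ _∷_ (all x) (∈-allVecs all v)

  ∈-allAffMaps : (L : AffMap F m n) → L ∈ allAffMaps F m n
  ∈-allAffMaps (M , w) = ∈-cartesianProductWith⁺ _,_ (∈-allVecs ∈-pts M) (∈-pts w)

  -- `Extends` goes through `zip`, which truncates, so equality of lengths has to be supplied from
  -- outside. `IsHom` has it built in.
  Extends⇒map : ∀ {B : List (V m)} {t : List (V n)} {L} → length t ≡ length B → Extends F B t L → t ≡ map (applyAff′ L) B
  Extends⇒map {B = []}    {[]}    _  _          = refl
  Extends⇒map {B = b ∷ B} {x ∷ t} eq (bx ∷ ext) = cong₂ _∷_ (sym bx) (Extends⇒map (suc-injective eq) ext)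

  map-extends : ∀ (B : List (V m)) (L : AffMap F m n) → Extends F B (map (applyAff′ L) B) L
  map-extends []      L = []
  map-extends (b ∷ B) L = refl ∷ map-extends B L

  extendable⇒IsHom : ∀ {B : List (V m)} {t : List (V n)} → length t ≡ length B →
    Any (Extends F B t) (allAffMaps F m n) → IsHom B t
  extendable⇒IsHom len ext with L , L-ext ← Any.satisfied ext = L , Extends⇒map len L-ext

  IsHom⇒extendable : ∀ {B : List (V m)} {t : List (V n)} → IsHom B t → Any (Extends F B t) (allAffMaps F m n)
  IsHom⇒extendable {B = B} (L , refl) = Any.map (λ { refl → map-extends B L }) (∈-allAffMaps L)

  length-∈-allTuples : ∀ {xs t : List X} k → t ∈ allTuples F xs k → length t ≡ k
  length-∈-allTuples zero (here refl) = refl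
  length-∈-allTuples {xs = xs} (suc k) t∈
    with x , t′ , x∈ , t′∈ , refl ← ∈-cartesianProductWith⁻ _∷_ xs (allTuples F xs k) t∈ =
    cong suc (length-∈-allTuples k t′∈)

  homs : List (V m) → List (V n) → List (List (V n))
  homs B A = filter (extendable? F B) (allTuples F A (length B))

  homs-unique : ∀ (B : List (V m)) {A : List (V n)} → Unique A → Unique (homs B A)
  homs-unique B u = UniqueP.filter⁺ (extendable? F B) (allTuples-unique u (length B))

  ∈-homs⁺ : ∀ {B : List (V m)} {A t : List (V n)} → All (_∈ A) t → IsHom B t → t ∈ homs B A
  ∈-homs⁺ {B = B} {A} {t} t⊆A hom = ∈-filter⁺ (extendable? F B)
    (subst (λ k → t ∈ allTuples F A k) (IsHom-length hom) (∈-allTuples⁺ t⊆A)) (IsHom⇒extendable hom)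

  ∈-homs⁻ : ∀ {B : List (V m)} {A t : List (V n)} → t ∈ homs B A → All (_∈ A) t × IsHom B t
  ∈-homs⁻ {B = B} t∈ with t∈tuples , ext ← ∈-filter⁻ (extendable? F B) t∈ =
    ∈-allTuples⁻ (length B) t∈tuples , extendable⇒IsHom (length-∈-allTuples (length B) t∈tuples) ext

  length-unique-≤ : ∀ {A : List (V n)} → Unique A → length A ≤ q ^ n
  length-unique-≤ {n} {A} u = ≤-trans
    (length-injection _≡_ A (pts n) u (λ {x} _ → x , ∈-pts x , refl) (λ { refl refl → refl }))
    (≤-reflexive (length-pts n))

  -- Homomorphisms that vanish at the base point

  module _ {m n : ℕ} (x₀ : V m) (B′ : List (V m)) where
    private
      B = x₀ ∷ B′

    -- The index set of the Jensen step: one representative, with value `𝟎` at x₀, for each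
    -- translation class of homomorphisms from B to the whole space.
    basedHoms : List (List (V n))
    basedHoms = filter (extendable? F B) (map (𝟎 ∷_) (allTuples F (pts n) (length B′)))

    basedHoms-unique : Unique basedHoms
    basedHoms-unique = UniqueP.filter⁺ (extendable? F B) {map (𝟎 ∷_) (allTuples F (pts n) (length B′))}
      (UniqueP.map⁺ (proj₂ ∘ ∷-injective) (allTuples-unique (pts-unique n) (length B′)))

    ∈-basedHoms⁺ : ∀ {t} → IsHom B (𝟎 ∷ t) → 𝟎 ∷ t ∈ basedHoms
    ∈-basedHoms⁺ {t} hom = ∈-filter⁺ (extendable? F B)
      (∈-map⁺ (𝟎 ∷_) (subst (λ k → t ∈ allTuples F (pts n) k) (suc-injective (IsHom-length hom))
        (∈-allTuples⁺ (All.universal ∈-pts t))))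
      (IsHom⇒extendable hom)

    ∈-basedHoms⁻ : ∀ {t} → t ∈ basedHoms → (∃ λ t′ → t ≡ 𝟎 ∷ t′) × IsHom B t
    ∈-basedHoms⁻ t∈ with t∈map , ext ← ∈-filter⁻ (extendable? F B) {xs = map (𝟎 ∷_) (allTuples F (pts n) (length B′))} t∈
      with t′ , t′∈ , refl ← ∈-map⁻ (𝟎 ∷_) t∈map =
      (t′ , refl) , extendable⇒IsHom (cong suc (length-∈-allTuples (length B′) t′∈)) ext

    -- A based homomorphism together with a translation vector amounts to an arbitrary homomorphism
    -- into the whole space, and this is determined by its values on an affine basis.
    length-basedHoms : (β : AffBasis B) → length basedHoms * q ^ n ≤ (q ^ n) ^ length (AffBasis.basis β)
    length-basedHoms β = begin
      length basedHoms * q ^ n               ≡⟨ cong (length basedHoms *_) (length-pts n) ⟨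
      length basedHoms * length (pts n)      ≡⟨ length-cartesianProductWith _,_ basedHoms (pts n) ⟨
      length (cartesianProduct basedHoms (pts n)) ≤⟨ length-injection R _ _ (UniqueP.cartesianProduct⁺ basedHoms-unique (pts-unique n)) total injective ⟩
      length (allTuples F (pts n) (length basis)) ≡⟨ length-allTuples (pts n) (length basis) ⟩
      length (pts n) ^ length basis          ≡⟨ cong (_^ length basis) (length-pts n) ⟩
      (q ^ n) ^ length basis                 ∎
      where
      open ≤-Reasoning
      open AffBasis β
      R : List (V n) × V n → List (V n) → Set
      R (t , v) s = (∃ λ t′ → t ≡ 𝟎 ∷ t′) × ∃ λ L → translate v t ≡ map (applyAff′ L) B × s ≡ map (applyAff′ L) basis
      total : ∀ {p} → p ∈ cartesianProduct basedHoms (pts n) → ∃ λ s → s ∈ allTuples F (pts n) (length basis) × R p s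
      total {t , v} p∈ with t∈ , _ ← ∈-cartesianProduct⁻ basedHoms (pts n) p∈
        with based , hom ← ∈-basedHoms⁻ t∈ with L , eq ← IsHom-translate {t = t} v hom =
        map (applyAff′ L) basis
        , subst (λ k → map (applyAff′ L) basis ∈ allTuples F (pts n) k) (length-map (applyAff′ L) basis)
            (∈-allTuples⁺ (All.universal ∈-pts _))
        , based , L , eq , refl
      agree : ∀ {L L′} → map (applyAff′ L) basis ≡ map (applyAff′ L′) basis →
        ∀ C → (∀ {b} → b ∈ C → InSpan basis b) → map (applyAff′ L) C ≡ map (applyAff′ {m} {n} L′) C
      agree eq []      span = refl
      agree eq (b ∷ C) span = cong₂ _∷_ (agree-on-span eq (span (here refl))) (agree eq C (span ∘ there))
      injective : ∀ {p p′ s} → R p s → R p′ s → p ≡ p′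
      injective {t , v} {u , w} ((t′ , refl) , L , eq , refl) ((u′ , refl) , L′ , eq′ , s≡)
        -- Since t and u start with `𝟎`, the heads of the two translates are v and w up to adding
        -- `𝟎`.
        with v≡w , t≡u ← ∷-injective (trans eq (trans (agree s≡ B spanning) (sym eq′)))
        with refl ← ⊕-cancelˡ 𝟎 v≡w =
        cong (λ z → 𝟎 ∷ z , v) (map-injective (⊕-cancelʳ v) t≡u)

  open module Dec∈ {n} = DecMembership (_≟ⱽ_ {n}) using (_∈?_)

  -- The set A_t, with t given by its list of values.
  shifts : List (V n) → List (V n) → List (V n)
  shifts {n} A t = filter (λ v → All.all? (λ x → (x ⊕ v) ∈? A) t) (pts n)

  shifts-unique : ∀ (A t : List (V n)) → Unique (shifts A t)
  shifts-unique A t = UniqueP.filter⁺ _ (pts-unique _)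

  ∈-shifts⁻ : ∀ {A t : List (V n)} {v} → v ∈ shifts A t → All (λ x → x ⊕ v ∈ A) t
  ∈-shifts⁻ {n} {A} {t} v∈ = proj₂ (∈-filter⁻ (λ v → All.all? (λ x → (x ⊕ v) ∈? A) t) {xs = pts n} v∈)

  -- A homomorphism φ into A is sent to the pair of φ - φ(x₀) and φ(x₀), from which it is recovered
  -- by translation.
  homAff-≤-shifts : ∀ (x₀ : V m) B′ {A : List (V n)} → Unique A →
    homAff F (x₀ ∷ B′) A ≤ sum (map (length ∘ shifts A) (basedHoms x₀ B′))
  homAff-≤-shifts {m} {n} x₀ B′ {A} u = ≤-trans
    (length-injection R (homs B A) (dependentPairs 𝓛 (shifts A)) (homs-unique B u) total (λ { refl refl → refl }))
    (≤-reflexive (length-dependentPairs 𝓛 (shifts A)))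
    where
    B = x₀ ∷ B′
    𝓛 = basedHoms {n = n} x₀ B′
    R : List (V n) → List (V n) × V n → Set
    R φ (t , v) = φ ≡ translate v t
    decompose : ∀ φ → All (_∈ A) φ × IsHom B φ → ∃ λ p → p ∈ dependentPairs 𝓛 (shifts A) × R φ p
    decompose []       (_   , _ , ())
    decompose (v ∷ φ′) (φ⊆A , hom) = (t , v) , ∈-dependentPairs⁺ t∈ v∈ , φ≡
      where
      t = translate (⊖ v) (v ∷ φ′)
      t∈ : t ∈ 𝓛
      t∈ = subst (_∈ 𝓛) (cong (_∷ translate (⊖ v) φ′) (sym (⊕-inverseʳ v)))
        (∈-basedHoms⁺ x₀ B′ (subst (λ z → IsHom B (z ∷ translate (⊖ v) φ′)) (⊕-inverseʳ v) (IsHom-translate (⊖ v) hom)))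
      undo : ∀ x → x ≡ (x ⊕ (⊖ v)) ⊕ v
      undo x = sym (trans (⊕-assoc x (⊖ v) v) (trans (cong (x ⊕_) (⊕-inverseˡ v)) (⊕-identityʳ x)))
      φ≡ : v ∷ φ′ ≡ translate v t
      φ≡ = trans (sym (map-id _)) (trans (map-cong undo _) (map-∘ (v ∷ φ′)))
      v∈ : v ∈ shifts A t
      v∈ = ∈-filter⁺ (λ v → All.all? (λ x → (x ⊕ v) ∈? A) t) (∈-pts v) (AllP.map⁻ (subst (All (_∈ A)) φ≡ φ⊆A))
    total : ∀ {φ} → φ ∈ homs B A → ∃ λ p → p ∈ dependentPairs 𝓛 (shifts A) × R φ p
    total {φ} φ∈ = decompose φ (∈-homs⁻ {B = B} φ∈)

  -- The pair (t, s) is sent to t(x) + s(y), whose values lie in A because those of s lie in A_t.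
  -- The product is listed in blocks, one for each x: the block of x₀ is s itself, and then the
  -- first entry of each block gives t(x).
  homAff-×-≥ : ∀ (x₀ : V m₁) B₁′ (y₀ : V m₂) B₂′ {A : List (V n)} → Unique A →
    sum (map (λ t → homAff F (y₀ ∷ B₂′) (shifts A t)) (basedHoms x₀ B₁′)) ≤ homAff F (_×ᴮ_ F (x₀ ∷ B₁′) (y₀ ∷ B₂′)) A
  homAff-×-≥ {n = n} x₀ B₁′ y₀ B₂′ {A} u = ≤-trans (≤-reflexive (sym (length-dependentPairs 𝓛 (homs B₂ ∘ shifts A))))
    (length-injection R _ _
      (dependentPairs-unique (basedHoms-unique x₀ B₁′) (λ t → homs-unique B₂ (shifts-unique A t))) total injective)
    where
    B₁ = x₀ ∷ B₁′
    B₂ = y₀ ∷ B₂′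
    𝓛 = basedHoms {n = n} x₀ B₁′
    R : List (V n) × List (V n) → List (V n) → Set
    R (t , s) φ = (∃ λ t′ → t ≡ 𝟎 ∷ t′) × length t ≡ length B₁ × length s ≡ length B₂ × φ ≡ cartesianProductWith _⊕_ t s
    total : ∀ {p} → p ∈ dependentPairs 𝓛 (homs B₂ ∘ shifts A) → ∃ λ φ → φ ∈ homs (_×ᴮ_ F B₁ B₂) A × R p φ
    total {t , s} p∈ with t∈ , s∈ ← ∈-dependentPairs⁻ 𝓛 p∈
      with based , t-hom ← ∈-basedHoms⁻ x₀ B₁′ t∈ | s⊆ , s-hom ← ∈-homs⁻ {B = B₂} s∈ =
      cartesianProductWith _⊕_ t s
      , ∈-homs⁺ {B = _×ᴮ_ F B₁ B₂} (All.tabulate in-A) (IsHom-× t-hom s-hom)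
      , based , IsHom-length t-hom , IsHom-length s-hom , refl
      where
      in-A : ∀ {z} → z ∈ cartesianProductWith _⊕_ t s → z ∈ A
      in-A z∈ with x , y , x∈ , y∈ , refl ← ∈-cartesianProductWith⁻ _⊕_ t s z∈ =
        All.lookup (∈-shifts⁻ (All.lookup s⊆ y∈)) x∈
    ++-cancel : ∀ {X : Set} {as bs cs ds : List X} → length as ≡ length bs →
      as ++ cs ≡ bs ++ ds → as ≡ bs × cs ≡ ds
    ++-cancel {as = []}     {[]}     _   eq = refl , eq
    ++-cancel {as = a ∷ as} {b ∷ bs} len eq with eq₁ , eq₂ ← ∷-injective eq
      with as≡ , cs≡ ← ++-cancel (suc-injective len) eq₂ = cong₂ _∷_ eq₁ as≡ , cs≡
    recover : ∀ {s₀ s′} {t u : List (V n)} → length t ≡ length u →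
      cartesianProductWith _⊕_ t (s₀ ∷ s′) ≡ cartesianProductWith _⊕_ u (s₀ ∷ s′) → t ≡ u
    recover {t = []}    {[]}    _   _  = refl
    recover {s₀} {s′} {x ∷ t} {y ∷ u} len eq with eq₁ , eq₂ ← ∷-injective eq
      with _ , rest ← ++-cancel (trans (length-map (x ⊕_) s′) (sym (length-map (y ⊕_) s′))) eq₂ =
      cong₂ _∷_ (⊕-cancelʳ s₀ eq₁) (recover (suc-injective len) rest)
    injective : ∀ {p p′ φ} → R p φ → R p′ φ → p ≡ p′
    injective {t , s₀ ∷ s′} {u , r} ((t′ , refl) , lt , ls , refl) ((u′ , refl) , lu , lr , eq)
      -- The block of x₀ is s shifted by `𝟎`; as s and r have equal length, the blocks can be
      -- compared.
      with heads , _ ← ++-cancel (trans (length-map (𝟎 ⊕_) (s₀ ∷ s′)) (trans ls (trans (sym lr) (sym (length-map (𝟎 ⊕_) r))))) eq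
      with refl ← trans (sym (trans (map-cong ⊕-identityˡ (s₀ ∷ s′)) (map-id _))) (trans heads (trans (map-cong ⊕-identityˡ r) (map-id _))) =
      cong (_, s₀ ∷ s′) (recover (trans lt (sym lu)) eq)

  -- The bound on the exponent, empty factors and the product theorem

  InSpan⇒nonempty : ∀ {b : V m} {S} → InSpan S b → 0 < length S
  InSpan⇒nonempty {S = []}    ([] , 0≡1 , _) = ⊥-elim (FiniteField.0≢1 F 0≡1)
  InSpan⇒nonempty {S = _ ∷ _} _              = z<s

  -- Testing against a one-point set A ⊆ 𝔽_q shows C ≥ rank, hence C ≥ 1.
  weaklySidorenko⇒≤ : ∀ (y₀ : V m) B′ a b → WeaklySidorenko F (y₀ ∷ B′) a b → b ≤ a
  weaklySidorenko⇒≤ y₀ B′ a b ws = ≤-trans (m≤n*m b r {{>-nonZero (InSpan⇒nonempty (spanning (here refl)))}})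
    (≮⇒≥ λ a<rb → <⇒≱ (^-monoʳ-< (q ^ 1) 1<q¹ a<rb) (begin
      (q ^ 1) ^ (r * b)            ≡⟨ *-identityˡ _ ⟨
      1 * (q ^ 1) ^ (r * b)        ≡⟨ cong (_* (q ^ 1) ^ (r * b)) (^-zeroˡ a) ⟨
      1 ^ a * (q ^ 1) ^ (r * b)    ≤⟨ ws r (affBasis-rank β) 1 (𝟎 ∷ []) ([] ∷ []) ⟩
      homAff F B (𝟎 {1} ∷ []) ^ b * (q ^ 1) ^ a ≤⟨ *-monoˡ-≤ ((q ^ 1) ^ a) (^-monoˡ-≤ b one-hom) ⟩
      1 ^ b * (q ^ 1) ^ a          ≡⟨ trans (cong (_* (q ^ 1) ^ a) (^-zeroˡ b)) (*-identityˡ _) ⟩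
      (q ^ 1) ^ a                  ∎))
    where
    open ≤-Reasoning
    B = y₀ ∷ B′
    β = affBasis B
    open AffBasis β
    r = length basis
    1<q¹ : 1 < q ^ 1
    1<q¹ = subst (1 <_) (sym (^-identityʳ q)) 1<q
    one-hom : homAff F B (𝟎 {1} ∷ []) ≤ 1
    one-hom = ≤-trans (length-filter (extendable? F B) (allTuples F (𝟎 {1} ∷ []) (length B)))
      (≤-reflexive (trans (length-allTuples (𝟎 {1} ∷ []) (length B)) (^-zeroˡ (length B))))

  -- The rank is 0 and the empty tuple is a homomorphism, so the claim reduces to |A| ≤ N.
  weaklySidorenko-[] : ∀ a b → WeaklySidorenko F {m} [] a b
  weaklySidorenko-[] a b r ((_ , [] , _ , refl) , _) n A u = begin
    length A ^ a * 1                ≡⟨ *-identityʳ _ ⟩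
    length A ^ a                    ≤⟨ ^-monoˡ-≤ a (length-unique-≤ u) ⟩
    (q ^ n) ^ a                     ≡⟨ *-identityˡ _ ⟨
    1 * (q ^ n) ^ a                 ≡⟨ cong (_* (q ^ n) ^ a) (^-zeroˡ b) ⟨
    1 ^ b * (q ^ n) ^ a             ≤⟨ *-monoˡ-≤ ((q ^ n) ^ a) (^-monoˡ-≤ b (∈-length (∈-homs⁺ {B = []} {A = A} [] (L₀ , refl)))) ⟩
    homAff F [] A ^ b * (q ^ n) ^ a ∎
    where
    open ≤-Reasoning
    L₀ = Vec.replicate n 𝟎 , 𝟎

  weaklySidorenko-× : (B₁ : List (V m₁)) (B₂ : List (V m₂)) → ∀ a₁ b₁ a₂ b₂ → .{{NonZero b₂}} →
    WeaklySidorenko F B₁ a₁ b₁ → WeaklySidorenko F B₂ a₂ b₂ → WeaklySidorenko F (_×ᴮ_ F B₁ B₂) (a₁ * a₂) (b₁ * b₂)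
  weaklySidorenko-× [] B₂ a₁ b₁ a₂ b₂ ws₁ ws₂ = weaklySidorenko-[] (a₁ * a₂) (b₁ * b₂)
  weaklySidorenko-× B₁@(_ ∷ _) [] a₁ b₁ a₂ b₂ ws₁ ws₂ =
    subst (λ B → WeaklySidorenko F B (a₁ * a₂) (b₁ * b₂)) (sym (cartesianProductWith-zeroʳ Vec._++_ B₁))
      (weaklySidorenko-[] (a₁ * a₂) (b₁ * b₂))
  -- T is an independent subset of the product with r elements, so bounding its length bounds the
  -- rank from above.
  weaklySidorenko-× {m₁} {m₂} B₁@(x₀ ∷ B₁′) B₂@(y₀ ∷ B₂′) a₁ b₁ a₂ b₂ ws₁ ws₂ r ((T , T⊆ , T-indep , refl) , _) n A u
    with e , refl ← m≤n⇒∃[o]m+o≡n (weaklySidorenko⇒≤ y₀ B₂′ a₂ b₂ ws₂) =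
    power-combine {length A} {N} {W} {H} {length 𝓛} {r} {r₁} {r₂} {a₁} b₁ b₂ e {{m^n≢0 q n {{q≢0}}}}
      (≤-trans (ws₁ r₁ (affBasis-rank β₁) n A u) (*-monoˡ-≤ (N ^ a₁) (^-monoˡ-≤ b₁ (homAff-≤-shifts x₀ B₁′ u))))
      (≤-trans (power-mean b₂ e (N ^ (r₂ * b₂)) (N ^ a₂′) (length ∘ shifts A) (λ t → homAff F B₂ (shifts A t)) 𝓛 fibre)
        (*-monoʳ-≤ (N ^ a₂′) (*-monoˡ-≤ (length 𝓛 ^ e) (^-monoˡ-≤ b₂ (homAff-×-≥ x₀ B₁′ y₀ B₂′ u)))))
      (length-basedHoms x₀ B₁′ β₁)
      (indep-product-length-< (AffBasis.basis β₁) (AffBasis.basis β₂) T T-indep span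
        -- The affine coordinates of y₀ serve as the vector e of coefficient sum 1.
        (proj₁ (AffBasis.spanning β₂ (here refl))) (proj₁ (proj₂ (AffBasis.spanning β₂ (here refl)))))
    where
    open ≤-Reasoning
    a₂′ = b₂ + e
    N = q ^ n
    q≢0 : NonZero q
    q≢0 = >-nonZero (<-trans z<s 1<q)
    β₁ = affBasis B₁
    β₂ = affBasis B₂
    r₁ = length (AffBasis.basis β₁)
    r₂ = length (AffBasis.basis β₂)
    𝓛 = basedHoms {n = n} x₀ B₁′
    W = sum (map (length ∘ shifts A) 𝓛)
    H = homAff F (_×ᴮ_ F B₁ B₂) A
    fibre : ∀ t → t ∈ 𝓛 → N ^ (r₂ * b₂) * length (shifts A t) ^ a₂′ ≤ N ^ a₂′ * homAff F B₂ (shifts A t) ^ b₂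
    fibre t _ = begin
      N ^ (r₂ * b₂) * length (shifts A t) ^ a₂′ ≡⟨ *-comm (N ^ (r₂ * b₂)) _ ⟩
      length (shifts A t) ^ a₂′ * N ^ (r₂ * b₂) ≤⟨ ws₂ r₂ (affBasis-rank β₂) n (shifts A t) (shifts-unique A t) ⟩
      homAff F B₂ (shifts A t) ^ b₂ * N ^ a₂′   ≡⟨ *-comm _ (N ^ a₂′) ⟩
      N ^ a₂′ * homAff F B₂ (shifts A t) ^ b₂   ∎
    span : ∀ {p} → p ∈ T → InSpan (AffBasis.basis β₁) (Vec.take m₁ p) × InSpan (AffBasis.basis β₂) (Vec.drop m₁ p)
    span {p} p∈ with x , y , x∈ , y∈ , refl ← ∈-cartesianProductWith⁻ Vec._++_ B₁ B₂ (lookup T⊆ p∈)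
      with take≡ , drop≡ ← VecP.++-injective (Vec.take m₁ (x Vec.++ y)) x (VecP.take++drop≡id m₁ (x Vec.++ y)) =
      subst (InSpan _) (sym take≡) (AffBasis.spanning β₁ x∈) , subst (InSpan _) (sym drop≡) (AffBasis.spanning β₂ y∈)

theorem1p12 : (F : FiniteField) {m₁ m₂ : ℕ}
    (B₁ : List (Pt F m₁)) (B₂ : List (Pt F m₂)) → Unique B₁ → Unique B₂ →
    ((a₁ b₁ a₂ b₂ : ℕ) → NonZero b₁ → NonZero b₂ →
    WeaklySidorenko F B₁ a₁ b₁ → WeaklySidorenko F B₂ a₂ b₂ →
    WeaklySidorenko F (_×ᴮ_ F B₁ B₂) (a₁ * a₂) (b₁ * b₂))
    × (Sidorenko F B₁ → Sidorenko F B₂ → Sidorenko F (_×ᴮ_ F B₁ B₂))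
theorem1p12 F B₁ B₂ _ _ = (λ a₁ b₁ a₂ b₂ _ b₂≢0 → weaklySidorenko-× B₁ B₂ a₁ b₁ a₂ b₂ {{b₂≢0}})
  -- The Sidorenko exponents are the sizes, and the size of the product set is the product of the
  -- sizes.
  , λ s₁ s₂ → subst (λ a → WeaklySidorenko F (_×ᴮ_ F B₁ B₂) a 1)
      (sym (length-cartesianProductWith Vec._++_ B₁ B₂)) (weaklySidorenko-× B₁ B₂ (length B₁) 1 (length B₂) 1 s₁ s₂)
  where open Homomorphisms F
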